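{- $\mathsf{DNR}_k\equiv^{<\omega}_\omega\mathsf{DNR}_2$ for any $k\ge2$. Indeed, for any $k\in\mathbb N$, the direction $\mathsf{DNR}_k\le^{<\omega}_\omega\mathsf{DNR}_{k^2}$ is witnessed by a team consisting of a confident learner and an eventually-Popperian learner; that is, there are a confident learner $\Psi_0$ and an eventually-Popperian learner $\Psi_1$ such that for every $g\in\mathsf{DNR}_{k^2}$ there is $i\in\{0,1\}$ for which $\lim_n\Psi_i(g\upharpoonright n)$ exists and $\Phi_{\lim_n\Psi_i(g\upharpoonright n)}(g)\in\mathsf{DNR}_k$. In particular, $\mathsf{DNR}_k\equiv^\omega_1\mathsf{DNR}_2$ for any $k\ge2$.
   Context: $\mathsf{DNR}_k$ is the set of all $k$-valued diagonally noncomputable functions, i.e. all total $f:\mathbb N\to\mathbb N$ with $f(n)<k$ for every $n$ and $f(e)\neq\Phi_e(e)$ whenever $\Phi_e(e)$ converges (here $\Phi_e(e)$ is the value of the $e$-th partial computable function on $\mathbb N$ at $e$). Let also $\{\Phi_e\}_{e\in\mathbb N}$ denote an effective enumeration of all partial computable functions $\Phi_e:\subseteq\mathbb N^{\mathbb N}\to\mathbb N^{\mathbb N}$. A learner is a total computable function $\Psi:\mathbb N^{<\mathbb N}\to\mathbb N$; let $\{\Psi^*_e\}_{e\in\mathbb N}$ be an effective enumeration of all learners. A learner $\Psi$ is confident if $\lim_n\Psi(f\upharpoonright n)$ converges for every $f\in\mathbb N^{\mathbb N}$. A learner $\Psi$ is eventually-Popperian if, for every $f\in\mathbb N^{\mathbb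 N}$, $\Phi_{\lim_n\Psi(f\upharpoonright n)}(f)$ is total whenever $\lim_n\Psi(f\upharpoonright n)$ converges. A partial function $\Gamma:\subseteq\mathbb N^{\mathbb N}\to\mathbb N^{\mathbb N}$ is $(<\omega,\omega)$-computable if there is $b\in\mathbb N$ such that for every $g\in\mathrm{dom}(\Gamma)$ there is $e<b$ such that $\lim_n\Psi^*_e(g\upharpoonright n)$ exists and $\Phi_{\lim_n\Psi^*_e(g\upharpoonright n)}(g)=\Gamma(g)$. $\Gamma$ is $(\omega,1)$-computable if $\Gamma(g)\le_Tg$ for every $g\in\mathrm{dom}(\Gamma)$. For $A,B\subseteq\mathbb N^{\mathbb N}$, $A\le^\alpha_\beta B$ means there is an $(\alpha,\beta)$-computable $\Gamma$ with $B\subseteq\mathrm{dom}(\Gamma)$ and $\Gamma(g)\in A$ for every $g\in B$; $A\equiv^\alpha_\beta B$ means $A\le^\alpha_\beta B$ and $B\le^\alpha_\beta A$. -}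

module Defs where

open import Data.List using (List; []; _∷_; applyUpTo)
open import Data.Nat using (ℕ; zero; suc; _+_; _≤_; _<_; s≤s)
open import Data.Nat.Properties
  using (+-comm; +-identityʳ; +-suc; suc-injective; ≤-trans; m≤m+n; m≤n+m)
open import Data.Product using (∃; _×_; _,_; proj₁; proj₂)
open import Data.Product.Properties using (,-injective)
open import Function.Definitions using (Injective)
open import Level using (0ℓ)
open import Relation.Binary.Definitions using (_Respects₂_)
open import Relation.Binary.PropositionalEquality
  using (_≡_; _≢_; _≗_; refl; sym; trans; cong; cong₂)
open import Relation.Unary using (Pred; _∈_; _⊆_)

-- Points of Baire space are identified up to pointwise equality _≗_.

Baire : Set
Baire = ℕ → ℕ

------------------------------------------------------------------------
-- Cantor's pairing bijection ℕ × ℕ → ℕ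

triangle : ℕ → ℕ
triangle zero    = zero
triangle (suc n) = suc (n + triangle n)

⟨_,_⟩ : ℕ → ℕ → ℕ
⟨ a , b ⟩ = triangle (a + b) + b

next : ℕ × ℕ → ℕ × ℕ
next (zero  , b) = suc b , zero
next (suc a , b) = a , suc b

unpair : ℕ → ℕ × ℕ
unpair zero    = zero , zero
unpair (suc n) = next (unpair n)

⟨⟩-next : ∀ p → ⟨ proj₁ (next p) , proj₂ (next p) ⟩ ≡ suc ⟨ proj₁ p , proj₂ p ⟩
⟨⟩-next (zero  , b) rewrite +-identityʳ b | +-identityʳ (b + triangle b) =
  cong suc (+-comm b (triangle b))
⟨⟩-next (suc a , b) rewrite +-suc a b = +-suc (triangle (suc (a + b))) b

⟨⟩-unpair : ∀ n → ⟨ proj₁ (unpair n) , proj₂ (unpair n) ⟩ ≡ n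
⟨⟩-unpair zero    = refl
⟨⟩-unpair (suc n) = trans (⟨⟩-next (unpair n)) (cong suc (⟨⟩-unpair n))

unpair-⟨⟩ : ∀ a b → unpair ⟨ a , b ⟩ ≡ (a , b)
unpair-⟨⟩ a b = go (a + b) a b refl
  where
  go : ∀ s a b → a + b ≡ s → unpair ⟨ a , b ⟩ ≡ (a , b)
  go s zero zero _ = refl
  go (suc s) (suc a) zero eq =
    trans (cong unpair (⟨⟩-next (zero , a)))
      (cong next (go s zero a (trans (sym (+-identityʳ a)) (suc-injective eq))))
  go s a (suc b) eq =
    trans (cong unpair (⟨⟩-next (suc a , b)))
      (cong next (go s (suc a) b (trans (sym (+-suc a b)) eq)))

⟨⟩-injective : ∀ {a b c d} → ⟨ a , b ⟩ ≡ ⟨ c , d ⟩ → a ≡ c × b ≡ d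
⟨⟩-injective {a} {b} {c} {d} eq =
  ,-injective (trans (sym (unpair-⟨⟩ a b)) (trans (cong unpair eq) (unpair-⟨⟩ c d)))

------------------------------------------------------------------------
-- Programs: the partial recursive functions relative to an oracle,
-- with several arguments passed as one number through ⟨_,_⟩

data Code : Set where
  zero succ fst snd oracle : Code
  pair comp prec           : Code → Code → Code
  mu                       : Code → Code

-- f ⊢ c · x ⇓ y : program c with oracle f halts on input x with output y.
-- On ⟨ a , n ⟩, mu c searches upwards from n for a zero of c on ⟨ a , _ ⟩.

infix 4 _⊢_·_⇓_

data _⊢_·_⇓_ (f : Baire) : Code → ℕ → ℕ → Set where
  zero      : ∀ {x} → f ⊢ zero · x ⇓ 0
  succ      : ∀ {x} → f ⊢ succ · x ⇓ suc x
  fst       : ∀ {a b} → f ⊢ fst · ⟨ a , b ⟩ ⇓ a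
  snd       : ∀ {a b} → f ⊢ snd · ⟨ a , b ⟩ ⇓ b
  oracle    : ∀ {x} → f ⊢ oracle · x ⇓ f x
  pair      : ∀ {c d x a b} → f ⊢ c · x ⇓ a → f ⊢ d · x ⇓ b →
              f ⊢ pair c d · x ⇓ ⟨ a , b ⟩
  comp      : ∀ {c d x y z} → f ⊢ d · x ⇓ y → f ⊢ c · y ⇓ z →
              f ⊢ comp c d · x ⇓ z
  prec-zero : ∀ {c d a y} → f ⊢ c · a ⇓ y →
              f ⊢ prec c d · ⟨ a , 0 ⟩ ⇓ y
  prec-suc  : ∀ {c d a n r y} →
              f ⊢ prec c d · ⟨ a , n ⟩ ⇓ r → f ⊢ d · ⟨ a , ⟨ n , r ⟩ ⟩ ⇓ y →
              f ⊢ prec c d · ⟨ a , suc n ⟩ ⇓ y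
  mu-found  : ∀ {c a n} → f ⊢ c · ⟨ a , n ⟩ ⇓ 0 →
              f ⊢ mu c · ⟨ a , n ⟩ ⇓ n
  mu-next   : ∀ {c a n m y} →
              f ⊢ c · ⟨ a , n ⟩ ⇓ suc m → f ⊢ mu c · ⟨ a , suc n ⟩ ⇓ y →
              f ⊢ mu c · ⟨ a , n ⟩ ⇓ y

⇓-deterministic : ∀ {f c x x′ y y′} → x ≡ x′ →
                  f ⊢ c · x ⇓ y → f ⊢ c · x′ ⇓ y′ → y ≡ y′
⇓-deterministic eq zero zero = refl
⇓-deterministic eq succ succ = cong suc eq
⇓-deterministic eq (fst {a} {b}) (fst {c} {d}) = proj₁ (⟨⟩-injective {a} {b} {c} {d} eq)
⇓-deterministic eq (snd {a} {b}) (snd {c} {d}) = proj₂ (⟨⟩-injective {a} {b} {c} {d} eq)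
⇓-deterministic {f} eq oracle oracle = cong f eq
⇓-deterministic eq (pair p q) (pair p′ q′) =
  cong₂ ⟨_,_⟩ (⇓-deterministic eq p p′) (⇓-deterministic eq q q′)
⇓-deterministic eq (comp p q) (comp p′ q′) =
  ⇓-deterministic (⇓-deterministic eq p p′) q q′
⇓-deterministic eq (prec-zero {a = a} p) (prec-zero {a = b} q) =
  ⇓-deterministic (proj₁ (⟨⟩-injective {a} {0} {b} {0} eq)) p q
⇓-deterministic eq (prec-zero {a = a} _) (prec-suc {a = b} {n} _ _)
  with () ← proj₂ (⟨⟩-injective {a} {0} {b} {suc n} eq)
⇓-deterministic eq (prec-suc {a = a} {n} _ _) (prec-zero {a = b} _)
  with () ← proj₂ (⟨⟩-injective {a} {suc n} {b} {0} eq)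
⇓-deterministic eq (prec-suc {a = a} {n} p q) (prec-suc {a = b} {m} p′ q′)
  with refl , refl ← ⟨⟩-injective {a} {suc n} {b} {suc m} eq =
  ⇓-deterministic (cong (λ r → ⟨ a , ⟨ n , r ⟩ ⟩) (⇓-deterministic refl p p′)) q q′
⇓-deterministic eq (mu-found {a = a} {n} p) (mu-found {a = b} {m} q) =
  proj₂ (⟨⟩-injective {a} {n} {b} {m} eq)
⇓-deterministic eq (mu-found p) (mu-next q _) with () ← ⇓-deterministic eq p q
⇓-deterministic eq (mu-next p _) (mu-found q) with () ← ⇓-deterministic eq p q
⇓-deterministic eq (mu-next {a = a} {n} _ p) (mu-next {a = b} {m} _ q)
  with refl , refl ← ⟨⟩-injective {a} {n} {b} {m} eq = ⇓-deterministic refl p q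

------------------------------------------------------------------------
-- Gödel numbering

⌜_⌝ : Code → ℕ
⌜ zero ⌝     = ⟨ 0 , 0 ⟩
⌜ succ ⌝     = ⟨ 1 , 0 ⟩
⌜ fst ⌝      = ⟨ 2 , 0 ⟩
⌜ snd ⌝      = ⟨ 3 , 0 ⟩
⌜ oracle ⌝   = ⟨ 4 , 0 ⟩
⌜ pair c d ⌝ = ⟨ 5 , ⟨ ⌜ c ⌝ , ⌜ d ⌝ ⟩ ⟩
⌜ comp c d ⌝ = ⟨ 6 , ⟨ ⌜ c ⌝ , ⌜ d ⌝ ⟩ ⟩
⌜ prec c d ⌝ = ⟨ 7 , ⟨ ⌜ c ⌝ , ⌜ d ⌝ ⟩ ⟩
⌜ mu c ⌝     = ⟨ 8 , ⌜ c ⌝ ⟩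

size : Code → ℕ
size (pair c d) = suc (size c + size d)
size (comp c d) = suc (size c + size d)
size (prec c d) = suc (size c + size d)
size (mu c)     = suc (size c)
size _          = 1

-- A left inverse of ⌜_⌝ on programs of size at most the first argument.

decode : ℕ → ℕ → Code
decode zero    _ = zero
decode (suc n) e with unpair e
... | 1 , _ = succ
... | 2 , _ = fst
... | 3 , _ = snd
... | 4 , _ = oracle
... | 5 , p = pair (decode n (proj₁ (unpair p))) (decode n (proj₂ (unpair p)))
... | 6 , p = comp (decode n (proj₁ (unpair p))) (decode n (proj₂ (unpair p)))
... | 7 , p = prec (decode n (proj₁ (unpair p))) (decode n (proj₂ (unpair p)))
... | 8 , p = mu (decode n p)
... | _ , _ = zero

decode-⌜⌝ : ∀ c {n} → size c ≤ n → decode n ⌜ c ⌝ ≡ c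
decode-⌜⌝ zero   (s≤s _) = refl
decode-⌜⌝ succ   (s≤s _) = refl
decode-⌜⌝ fst    (s≤s _) = refl
decode-⌜⌝ snd    (s≤s _) = refl
decode-⌜⌝ oracle (s≤s _) = refl
decode-⌜⌝ (pair c d) (s≤s le)
  rewrite unpair-⟨⟩ 5 ⟨ ⌜ c ⌝ , ⌜ d ⌝ ⟩ | unpair-⟨⟩ ⌜ c ⌝ ⌜ d ⌝ =
  cong₂ pair (decode-⌜⌝ c (≤-trans (m≤m+n _ _) le))
             (decode-⌜⌝ d (≤-trans (m≤n+m _ (size c)) le))
decode-⌜⌝ (comp c d) (s≤s le)
  rewrite unpair-⟨⟩ 6 ⟨ ⌜ c ⌝ , ⌜ d ⌝ ⟩ | unpair-⟨⟩ ⌜ c ⌝ ⌜ d ⌝ =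
  cong₂ comp (decode-⌜⌝ c (≤-trans (m≤m+n _ _) le))
             (decode-⌜⌝ d (≤-trans (m≤n+m _ (size c)) le))
decode-⌜⌝ (prec c d) (s≤s le)
  rewrite unpair-⟨⟩ 7 ⟨ ⌜ c ⌝ , ⌜ d ⌝ ⟩ | unpair-⟨⟩ ⌜ c ⌝ ⌜ d ⌝ =
  cong₂ prec (decode-⌜⌝ c (≤-trans (m≤m+n _ _) le))
             (decode-⌜⌝ d (≤-trans (m≤n+m _ (size c)) le))
decode-⌜⌝ (mu c) (s≤s le)
  rewrite unpair-⟨⟩ 8 ⌜ c ⌝ = cong mu (decode-⌜⌝ c le)

⌜⌝-injective : Injective _≡_ _≡_ ⌜_⌝
⌜⌝-injective {c} {d} eq =
  trans (sym (decode-⌜⌝ c (m≤m+n (size c) (size d))))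
    (trans (cong (decode (size c + size d)) eq)
      (decode-⌜⌝ d (m≤n+m (size d) (size c))))

-- Φ e ⟨ f ⟩ x ↓ y : the e-th partial computable functional satisfies
-- Φ_e(f)(x) = y.  A number that is not the code of a program is an index of
-- the nowhere defined functional.

infix 4 Φ_⟨_⟩_↓_ Φ_⟨_⟩↓_ φ_⟨_⟩↓_

Φ_⟨_⟩_↓_ : ℕ → Baire → ℕ → ℕ → Set
Φ e ⟨ f ⟩ x ↓ y = ∃ λ c → ⌜ c ⌝ ≡ e × f ⊢ c · x ⇓ y

Φ-deterministic : ∀ {e f x y y′} → Φ e ⟨ f ⟩ x ↓ y → Φ e ⟨ f ⟩ x ↓ y′ → y ≡ y′
Φ-deterministic (c , refl , p) (d , eq , q) with refl ← ⌜⌝-injective {d} {c} eq =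
  ⇓-deterministic refl p q

-- Φ_e(f) is defined as an element of Baire space, and equals h.

Φ_⟨_⟩↓_ : ℕ → Baire → Baire → Set
Φ e ⟨ f ⟩↓ h = ∀ x → Φ e ⟨ f ⟩ x ↓ h x

Total : ℕ → Baire → Set
Total e f = ∀ x → ∃ λ y → Φ e ⟨ f ⟩ x ↓ y

-- The partial computable functions on ℕ are enumerated by computing relative
-- to the constant zero oracle.

φ_⟨_⟩↓_ : ℕ → ℕ → ℕ → Set
φ e ⟨ x ⟩↓ y = Φ e ⟨ (λ _ → 0) ⟩ x ↓ y

------------------------------------------------------------------------
-- Diagonally noncomputable functions

DNR : ℕ → Pred Baire 0ℓ
DNR k f = (∀ n → f n < k) × (∀ {e y} → φ e ⟨ e ⟩↓ y → f e ≢ y)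

------------------------------------------------------------------------
-- Learners

_↾_ : Baire → ℕ → List ℕ
f ↾ n = applyUpTo f n

⌜_⌝* : List ℕ → ℕ
⌜ [] ⌝*    = 0
⌜ x ∷ σ ⌝* = suc ⟨ x , ⌜ σ ⌝* ⟩

-- The e-th learner Ψ*_e is σ ↦ φ_e(σ), and exists only for those e for which
-- this is total: no computable sequence of total functions lists all total
-- computable ones.

record Learner : Set where
  field
    fun      : List ℕ → ℕ
    index    : ℕ
    computes : ∀ σ → φ index ⟨ ⌜ σ ⌝* ⟩↓ fun σ

open Learner public

infix 4 Lim_⟨_⟩≡_

Lim_⟨_⟩≡_ : Learner → Baire → ℕ → Set
Lim Ψ ⟨ f ⟩≡ ℓ = ∃ λ N → ∀ n → N ≤ n → fun Ψ (f ↾ n) ≡ ℓ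

Confident : Learner → Set
Confident Ψ = ∀ f → ∃ λ ℓ → Lim Ψ ⟨ f ⟩≡ ℓ

EventuallyPopperian : Learner → Set
EventuallyPopperian Ψ = ∀ f {ℓ} → Lim Ψ ⟨ f ⟩≡ ℓ → Total ℓ f

-- The limit of Ψ along g exists and Φ_{lim Ψ}(g) = h.

Learns : Learner → Baire → Baire → Set
Learns Ψ g h = ∃ λ ℓ → Lim Ψ ⟨ g ⟩≡ ℓ × Φ ℓ ⟨ g ⟩↓ h

------------------------------------------------------------------------
-- Reducibilities

record PartialFunction : Set₁ where
  field
    graph      : Baire → Baire → Set
    respects   : graph Respects₂ _≗_
    functional : ∀ {g h h′} → graph g h → graph g h′ → h ≗ h′

  dom : Pred Baire 0ℓ
  dom g = ∃ λ h → graph g h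

open PartialFunction public

infix 4 _≤T_ _≤⟨_⟩_ _≡⟨_⟩_

_≤T_ : Baire → Baire → Set
h ≤T g = ∃ λ e → Φ e ⟨ g ⟩↓ h

⟨<ω,ω⟩-Computable : PartialFunction → Set
⟨<ω,ω⟩-Computable Γ =
  ∃ λ b → ∀ {g h} → graph Γ g h → ∃ λ Ψ → index Ψ < b × Learns Ψ g h

⟨ω,1⟩-Computable : PartialFunction → Set
⟨ω,1⟩-Computable Γ = ∀ {g h} → graph Γ g h → h ≤T g

_≤⟨_⟩_ : Pred Baire 0ℓ → (PartialFunction → Set) → Pred Baire 0ℓ → Set₁
A ≤⟨ C ⟩ B = ∃ λ Γ →
  C Γ × B ⊆ dom Γ × (∀ {g h} → g ∈ B → graph Γ g h → h ∈ A)

_≡⟨_⟩_ : Pred Baire 0ℓ → (PartialFunction → Set) → Pred Baire 0ℓ → Set₁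
A ≡⟨ C ⟩ B = A ≤⟨ C ⟩ B × B ≤⟨ C ⟩ A

{-# OPTIONS --safe #-}

-- Read a number w as the sequence of arguments (w)₀, (w)₁, … and g ∈ DNR (kⁿ)
-- as n-tuples of values below k.  There is a computable q such that the
-- program q(w) outputs on every input the tuple (φ_{(w)ᵢ}((w)ᵢ))_{i<n} if all
-- its components exist; hence the digits of g(q(w)) never match all of them.
-- Let j < n be such that for some a no w whose j+1-st tail is a has its digits
-- 0, …, j matched, whereas for every b some w whose j-th tail is b has its
-- digits 0, …, j-1 matched.  Given e, search for such a w for b = (e, a): the
-- j-th digit of g(q(w)) differs from φ_e(e), so this computes an element of
-- DNR k from g and a.  The least such a is learned in the limit, as matching
-- is enumerable; for j = n-1 every a will do, and for j = 0 the search always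
-- succeeds.  Hence for n = 2 one learner is constant and the other one is
-- eventually Popperian; n = k, with base 2, gives DNR 2 from DNR k ⊆ DNR (2ᵏ).

module Submission where

open import Defs
open import Axiom.ExcludedMiddle using (ExcludedMiddle)
open import Data.Empty using (⊥-elim)
open import Data.Fin using (Fin; zero; suc; #_)
open import Data.List using (_∷_)
open import Data.Nat
open import Data.Nat.DivMod
open import Data.Nat.Properties
open import Data.Product using (∃; ∃₂; _×_; _,_; proj₁; proj₂)
open import Data.Sum using (_⊎_; inj₁; inj₂; [_,_]′)
open import Data.Vec using (Vec; []; _∷_; lookup)
open import Function using (_∘_)
open import Level using (0ℓ)
open import Relation.Binary.PropositionalEquality
open import Relation.Nullary using (¬_; yes; no)
open import Relation.Nullary.Decidable using (decidable-stable)
open import Relation.Unary using (Pred; _∈_; _⊆_)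

-- Projections and basic programs

opaque
  π₁ π₂ : ℕ → ℕ
  π₁ x = proj₁ (unpair x)
  π₂ x = proj₂ (unpair x)

  π₁-⟨⟩ : ∀ a b → π₁ ⟨ a , b ⟩ ≡ a
  π₁-⟨⟩ a b = cong proj₁ (unpair-⟨⟩ a b)

  π₂-⟨⟩ : ∀ a b → π₂ ⟨ a , b ⟩ ≡ b
  π₂-⟨⟩ a b = cong proj₂ (unpair-⟨⟩ a b)

  ⟨⟩-η : ∀ x → ⟨ π₁ x , π₂ x ⟩ ≡ x
  ⟨⟩-η = ⟨⟩-unpair

⇓-fst : ∀ {f} x → f ⊢ fst · x ⇓ π₁ x
⇓-fst {f} x = subst (λ z → f ⊢ fst · z ⇓ π₁ x) (⟨⟩-η x) (fst {a = π₁ x} {π₂ x})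

⇓-snd : ∀ {f} x → f ⊢ snd · x ⇓ π₂ x
⇓-snd {f} x = subst (λ z → f ⊢ snd · z ⇓ π₂ x) (⟨⟩-η x) (snd {a = π₁ x} {π₂ x})

-- Pairing the two projections is the identity because Cantor's pairing is surjective.
idᶜ : Code
idᶜ = pair fst snd

⇓-id : ∀ {f} x → f ⊢ idᶜ · x ⇓ x
⇓-id {f} x = subst (λ z → f ⊢ idᶜ · x ⇓ z) (⟨⟩-η x) (pair (⇓-fst x) (⇓-snd x))

const : ℕ → Code
const zero    = zero
const (suc n) = comp succ (const n)

⇓-const : ∀ {f x} n → f ⊢ const n · x ⇓ n
⇓-const zero    = zero
⇓-const (suc n) = comp (⇓-const n) succ

-- A language of total programs and its compiler

infix 9 ⟪_,_⟫

-- Total programs with n variables.  A valuation of the variables is passed to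
-- the compiled program as one number, see env.

data Tm (n : ℕ) : Set where
  var       : Fin n → Tm n
  lit       : ℕ → Tm n
  sucᵗ predᵗ : Tm n → Tm n
  ⟪_,_⟫     : Tm n → Tm n → Tm n
  π₁ᵗ π₂ᵗ   : Tm n → Tm n
  oracleᵗ   : Tm n → Tm n
  ifz       : Tm n → Tm n → Tm n → Tm n
  rec       : Tm n → Tm (2 + n) → Tm n → Tm n
  call      : ∀ {m} → Tm m → Vec (Tm n) m → Tm n

if0 : ℕ → ℕ → ℕ → ℕ
if0 zero    x y = x
if0 (suc _) x y = y

natrec : ℕ → (ℕ → ℕ → ℕ) → ℕ → ℕ
natrec z s zero    = z
natrec z s (suc n) = s n (natrec z s n)

mutual
  ⟦_⟧ : ∀ {n} → Tm n → Baire → Vec ℕ n → ℕ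
  ⟦ var i ⟧     f ρ = lookup ρ i
  ⟦ lit m ⟧     f ρ = m
  ⟦ sucᵗ t ⟧    f ρ = suc (⟦ t ⟧ f ρ)
  ⟦ predᵗ t ⟧   f ρ = pred (⟦ t ⟧ f ρ)
  ⟦ ⟪ t , u ⟫ ⟧ f ρ = ⟨ ⟦ t ⟧ f ρ , ⟦ u ⟧ f ρ ⟩
  ⟦ π₁ᵗ t ⟧     f ρ = π₁ (⟦ t ⟧ f ρ)
  ⟦ π₂ᵗ t ⟧     f ρ = π₂ (⟦ t ⟧ f ρ)
  ⟦ oracleᵗ t ⟧ f ρ = f (⟦ t ⟧ f ρ)
  ⟦ ifz t u v ⟧ f ρ = if0 (⟦ t ⟧ f ρ) (⟦ u ⟧ f ρ) (⟦ v ⟧ f ρ)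
  ⟦ rec b s t ⟧ f ρ = natrec (⟦ b ⟧ f ρ) (λ i r → ⟦ s ⟧ f (r ∷ i ∷ ρ)) (⟦ t ⟧ f ρ)
  ⟦ call t us ⟧ f ρ = ⟦ t ⟧ f (⟦ us ⟧* f ρ)

  ⟦_⟧* : ∀ {n m} → Vec (Tm n) m → Baire → Vec ℕ n → Vec ℕ m
  ⟦ [] ⟧*     f ρ = []
  ⟦ u ∷ us ⟧* f ρ = ⟦ u ⟧ f ρ ∷ ⟦ us ⟧* f ρ

env : ∀ {n} → Vec ℕ n → ℕ
env []      = 0
env (x ∷ ρ) = ⟨ env ρ , x ⟩

projᶜ : ∀ {n} → Fin n → Code
projᶜ zero    = snd
projᶜ (suc i) = comp (projᶜ i) fst

mutual
  compile : ∀ {n} → Tm n → Code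
  compile (var i)     = projᶜ i
  compile (lit m)     = const m
  compile (sucᵗ t)    = comp succ (compile t)
  compile (predᵗ t)   = comp (prec zero (comp fst snd)) (pair zero (compile t))
  compile ⟪ t , u ⟫   = pair (compile t) (compile u)
  compile (π₁ᵗ t)     = comp fst (compile t)
  compile (π₂ᵗ t)     = comp snd (compile t)
  compile (oracleᵗ t) = comp oracle (compile t)
  -- A primitive recursion whose step discards the previous value decides whether its argument is 0.
  compile (ifz t u v) = comp (prec (compile u) (comp (compile v) fst)) (pair idᶜ (compile t))
  compile (rec b s t) =
    -- The step receives `⟨ env ρ , ⟨ i , r ⟩ ⟩` and regroups it as `env (r ∷ i ∷ ρ)`.
    comp (prec (compile b) (comp (compile s) (pair (pair fst (comp fst snd)) (comp snd snd))))
         (pair idᶜ (compile t))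
  compile (call t us) = comp (compile t) (compile* us)

  compile* : ∀ {n m} → Vec (Tm n) m → Code
  compile* []       = zero
  compile* (u ∷ us) = pair (compile* us) (compile u)

⇓-proj : ∀ {n f} (i : Fin n) ρ → f ⊢ projᶜ i · env ρ ⇓ lookup ρ i
⇓-proj zero    (x ∷ ρ) = snd {a = env ρ} {x}
⇓-proj (suc i) (x ∷ ρ) = comp (fst {a = env ρ} {x}) (⇓-proj i ρ)

⇓-pred : ∀ {f} m → f ⊢ prec zero (comp fst snd) · ⟨ 0 , m ⟩ ⇓ pred m
⇓-pred zero    = prec-zero {a = 0} zero
⇓-pred (suc m) =
  prec-suc {a = 0} {n = m} (⇓-pred m)
    (comp (snd {a = 0} {⟨ m , pred m ⟩}) (fst {a = m} {pred m}))

mutual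
  ⇓-compile : ∀ {n f} (t : Tm n) ρ → f ⊢ compile t · env ρ ⇓ ⟦ t ⟧ f ρ
  ⇓-compile (var i)     ρ = ⇓-proj i ρ
  ⇓-compile (lit m)     ρ = ⇓-const m
  ⇓-compile (sucᵗ t)    ρ = comp (⇓-compile t ρ) succ
  ⇓-compile {f = f} (predᵗ t) ρ = comp (pair zero (⇓-compile t ρ)) (⇓-pred (⟦ t ⟧ f ρ))
  ⇓-compile ⟪ t , u ⟫   ρ = pair (⇓-compile t ρ) (⇓-compile u ρ)
  ⇓-compile (π₁ᵗ t)     ρ = comp (⇓-compile t ρ) (⇓-fst _)
  ⇓-compile (π₂ᵗ t)     ρ = comp (⇓-compile t ρ) (⇓-snd _)
  ⇓-compile (oracleᵗ t) ρ = comp (⇓-compile t ρ) oracle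
  ⇓-compile {f = f} (ifz t u v) ρ = comp (pair (⇓-id _) (⇓-compile t ρ)) (branch (⟦ t ⟧ f ρ))
    where
    branch : ∀ m → f ⊢ prec (compile u) (comp (compile v) fst) · ⟨ env ρ , m ⟩ ⇓
                       if0 m (⟦ u ⟧ f ρ) (⟦ v ⟧ f ρ)
    branch zero    = prec-zero {a = env ρ} (⇓-compile u ρ)
    branch (suc m) =
      prec-suc {a = env ρ} {n = m} (branch m)
        (comp (fst {a = env ρ} {⟨ m , if0 m (⟦ u ⟧ f ρ) (⟦ v ⟧ f ρ) ⟩}) (⇓-compile v ρ))
  ⇓-compile {f = f} (rec b s t) ρ = comp (pair (⇓-id _) (⇓-compile t ρ)) (loop (⟦ t ⟧ f ρ))
    where
    r : ℕ → ℕ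
    r = natrec (⟦ b ⟧ f ρ) (λ i r → ⟦ s ⟧ f (r ∷ i ∷ ρ))

    loop : ∀ m → f ⊢ prec (compile b) (comp (compile s) (pair (pair fst (comp fst snd)) (comp snd snd))) ·
                     ⟨ env ρ , m ⟩ ⇓ r m
    loop zero    = prec-zero {a = env ρ} (⇓-compile b ρ)
    loop (suc m) =
      prec-suc {a = env ρ} {n = m} (loop m)
        (comp (pair (pair (fst {a = env ρ} {⟨ m , r m ⟩})
                          (comp (snd {a = env ρ} {⟨ m , r m ⟩}) (fst {a = m} {r m})))
                    (comp (snd {a = env ρ} {⟨ m , r m ⟩}) (snd {a = m} {r m})))
              (⇓-compile s (r m ∷ m ∷ ρ)))
  ⇓-compile (call t us) ρ = comp (⇓-compile* us ρ) (⇓-compile t _)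

  ⇓-compile* : ∀ {n m f} (us : Vec (Tm n) m) ρ → f ⊢ compile* us · env ρ ⇓ env (⟦ us ⟧* f ρ)
  ⇓-compile* []       ρ = zero
  ⇓-compile* (u ∷ us) ρ = pair (⇓-compile* us ρ) (⇓-compile u ρ)

-- Unbounded search

search : ∀ {n} → Tm (suc n) → Tm (suc n) → Code
search test out = comp (compile out) (pair idᶜ (comp (mu (compile test)) (pair idᶜ zero)))

-- The test is total and the search starts from 0, so it stops at `w` at the latest, possibly at an
-- earlier `u`. The induction in `upFrom` is on the distance `d` that remains to `w`.
⇓-search : ∀ {n f} (test out : Tm (suc n)) ρ {w} → ⟦ test ⟧ f (w ∷ ρ) ≡ 0 →
           ∃ λ u → ⟦ test ⟧ f (u ∷ ρ) ≡ 0 × f ⊢ search test out · env ρ ⇓ ⟦ out ⟧ f (u ∷ ρ)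
⇓-search {f = f} test out ρ {w} eq =
  let u , eq′ , p = upFrom w 0 (+-identityʳ w) in
  u , eq′ , comp (pair (⇓-id _) (comp (pair (⇓-id _) zero) p)) (⇓-compile out (u ∷ ρ))
  where
  upFrom : ∀ d m → d + m ≡ w →
           ∃ λ u → ⟦ test ⟧ f (u ∷ ρ) ≡ 0 × f ⊢ mu (compile test) · ⟨ env ρ , m ⟩ ⇓ u
  upFrom d m d+m≡w with ⟦ test ⟧ f (m ∷ ρ) in eqₘ | ⇓-compile {f = f} test (m ∷ ρ)
  ... | zero  | p = m , eqₘ , mu-found {a = env ρ} {m} p
  upFrom zero    m refl | suc _ | p with () ← trans (sym eqₘ) eq
  upFrom (suc d) m d+m≡w | suc _ | p
    with u , eq′ , p′ ← upFrom d (suc m) (trans (+-suc d m) d+m≡w) = u , eq′ , mu-next {a = env ρ} {m} p p′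

v0 : ∀ {n} → Tm (1 + n)
v0 = var (# 0)
v1 : ∀ {n} → Tm (2 + n)
v1 = var (# 1)
v2 : ∀ {n} → Tm (3 + n)
v2 = var (# 2)
v3 : ∀ {n} → Tm (4 + n)
v3 = var (# 3)

-- A machine for the diagonal computations

switch : ∀ {n m} → Tm n → Vec (Tm n) m → Tm n
switch t []       = lit 0
switch t (b ∷ bs) = ifz t b (switch (predᵗ t) bs)

-- The successor keeps 0 free for the empty stack, which marks a halted machine.
push : ℕ → ℕ → ℕ
push c K = suc ⟨ c , K ⟩

pushᵗ : ∀ {n} → Tm n → Tm n → Tm n
pushᵗ c K = sucᵗ ⟪ c , K ⟫

-- A state ⟨ x , K ⟩ of the machine consists of a value x and a stack K of
-- instructions, which are to be applied to x one after the other.  The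
-- instructions are Gödel numbers of programs, and moreover
--   ⟨ 9 , ⟨ x , d ⟩ ⟩               y ↦ (y , d(x))
--   ⟨ 10 , y ⟩                      z ↦ (y , z)
--   ⟨ 11 , ⟨ ⟨ a , n ⟩ , d ⟩ ⟩      r ↦ d(a , (n , r))
--   ⟨ 12 , ⟨ c , ⟨ a , n ⟩ ⟩ ⟩      r ↦ n if r = 0, and mu c (a , n + 1) otherwise.

opaque
  execute : Tm 4
  execute = switch tag
    ( ⟪ lit 0 , K ⟫
    ∷ ⟪ sucᵗ x , K ⟫
    ∷ ⟪ π₁ᵗ x , K ⟫
    ∷ ⟪ π₂ᵗ x , K ⟫
    ∷ ⟪ lit 0 , K ⟫
    ∷ ⟪ x , pushᵗ (π₁ᵗ p) (pushᵗ ⟪ lit 9 , ⟪ x , π₂ᵗ p ⟫ ⟫ K) ⟫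
    ∷ ⟪ x , pushᵗ (π₂ᵗ p) (pushᵗ (π₁ᵗ p) K) ⟫
    ∷ ifz (π₂ᵗ x)
        ⟪ π₁ᵗ x , pushᵗ (π₁ᵗ p) K ⟫
        ⟪ ⟪ π₁ᵗ x , predᵗ (π₂ᵗ x) ⟫ ,
          pushᵗ ⟪ lit 7 , p ⟫ (pushᵗ ⟪ lit 11 , ⟪ ⟪ π₁ᵗ x , predᵗ (π₂ᵗ x) ⟫ , π₂ᵗ p ⟫ ⟫ K) ⟫
    ∷ ⟪ x , pushᵗ p (pushᵗ ⟪ lit 12 , ⟪ p , x ⟫ ⟫ K) ⟫
    ∷ ⟪ π₁ᵗ p , pushᵗ (π₂ᵗ p) (pushᵗ ⟪ lit 10 , x ⟫ K) ⟫
    ∷ ⟪ ⟪ p , x ⟫ , K ⟫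
    ∷ ⟪ ⟪ π₁ᵗ (π₁ᵗ p) , ⟪ π₂ᵗ (π₁ᵗ p) , x ⟫ ⟫ , pushᵗ (π₂ᵗ p) K ⟫
    ∷ ifz x ⟪ π₂ᵗ (π₂ᵗ p) , K ⟫
            ⟪ ⟪ π₁ᵗ (π₂ᵗ p) , sucᵗ (π₂ᵗ (π₂ᵗ p)) ⟫ , pushᵗ ⟪ lit 8 , π₁ᵗ p ⟫ K ⟫
    ∷ [])
    where
    tag p x K : Tm 4
    tag = v0
    p   = v1
    x   = v2
    K   = v3

stepᵗ : Tm 1
stepᵗ = ifz (π₂ᵗ v0) v0
  (call execute
    ( π₁ᵗ (π₁ᵗ (predᵗ (π₂ᵗ v0)))
    ∷ π₂ᵗ (π₁ᵗ (predᵗ (π₂ᵗ v0)))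
    ∷ π₁ᵗ v0
    ∷ π₂ᵗ (predᵗ (π₂ᵗ v0))
    ∷ []))

𝟎 : Baire
𝟎 _ = 0

-- Abstracting over the instruction table keeps its thirteen cases out of arguments that only
-- concern the stack.
dispatch : (ℕ → ℕ → ℕ → ℕ → ℕ) → ℕ → ℕ
dispatch exec s = if0 (π₂ s) s (exec (π₁ (π₁ r)) (π₂ (π₁ r)) (π₁ s) (π₂ r))
  where r = pred (π₂ s)

dispatch-push : ∀ exec x tag p K → dispatch exec ⟨ x , push ⟨ tag , p ⟩ K ⟩ ≡ exec tag p x K
dispatch-push exec x tag p K
  rewrite π₂-⟨⟩ x (push ⟨ tag , p ⟩ K) | π₁-⟨⟩ x (push ⟨ tag , p ⟩ K)
        | π₁-⟨⟩ ⟨ tag , p ⟩ K | π₂-⟨⟩ ⟨ tag , p ⟩ K | π₁-⟨⟩ tag p | π₂-⟨⟩ tag p = refl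

opaque
  unfolding execute

  exec : ℕ → ℕ → ℕ → ℕ → ℕ
  exec tag p x K = ⟦ execute ⟧ 𝟎 (tag ∷ p ∷ x ∷ K ∷ [])

  ⟦execute⟧ : ∀ f tag p x K → ⟦ execute ⟧ f (tag ∷ p ∷ x ∷ K ∷ []) ≡ exec tag p x K
  ⟦execute⟧ f tag p x K = refl

step : ℕ → ℕ
step = dispatch exec

step-push : ∀ x tag p K → step ⟨ x , push ⟨ tag , p ⟩ K ⟩ ≡ exec tag p x K
step-push = dispatch-push exec

⟦stepᵗ⟧ : ∀ f s → ⟦ stepᵗ ⟧ f (s ∷ []) ≡ step s
⟦stepᵗ⟧ f s = cong (if0 (π₂ s) s) (⟦execute⟧ f (π₁ (π₁ r)) (π₂ (π₁ r)) (π₁ s) (π₂ r))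
  where r = pred (π₂ s)

run : ℕ → ℕ → ℕ
run s = natrec s (λ _ → step)

run-+ : ∀ s m n → run (run s m) n ≡ run s (n + m)
run-+ s m zero    = refl
run-+ s m (suc n) = cong step (run-+ s m n)

infix 4 _↝_
_↝_ : ℕ → ℕ → Set
s ↝ s′ = ∃ λ n → run s n ≡ s′

↝-refl : ∀ {s} → s ↝ s
↝-refl = 0 , refl

↝-trans : ∀ {s s′ s″} → s ↝ s′ → s′ ↝ s″ → s ↝ s″
↝-trans {s} (m , refl) (n , refl) = n + m , sym (run-+ s m n)

↝-push : ∀ x tag p K {s} → exec tag p x K ↝ s → ⟨ x , push ⟨ tag , p ⟩ K ⟩ ↝ s
↝-push x tag p K = ↝-trans (1 , step-push x tag p K)

↝-≡ : ∀ {s s′} → s ≡ s′ → s ↝ s′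
↝-≡ eq = 0 , eq

opaque
  unfolding exec

  exec-prec : ∀ c d a n K → exec 7 ⟨ c , d ⟩ ⟨ a , suc n ⟩ K ≡
              ⟨ ⟨ a , n ⟩ , push ⟨ 7 , ⟨ c , d ⟩ ⟩ (push ⟨ 11 , ⟨ ⟨ a , n ⟩ , d ⟩ ⟩ K) ⟩
  exec-prec c d a n K
    rewrite π₂-⟨⟩ a (suc n) | π₁-⟨⟩ a (suc n) | π₂-⟨⟩ c d = refl

  -- By induction on the derivation. The stack `K` is arbitrary, so that the induction hypothesis
  -- applies to a subprogram while the rest of the work is still pending.
  runs : ∀ {c x y} → 𝟎 ⊢ c · x ⇓ y → ∀ K → ⟨ x , push ⌜ c ⌝ K ⟩ ↝ ⟨ y , K ⟩
  runs {x = x} zero   K = ↝-push x 0 0 K ↝-refl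
  runs {x = x} succ   K = ↝-push x 1 0 K ↝-refl
  runs (fst {a} {b})  K = ↝-push ⟨ a , b ⟩ 2 0 K (↝-≡ (cong (λ z → ⟨ z , K ⟩) (π₁-⟨⟩ a b)))
  runs (snd {a} {b})  K = ↝-push ⟨ a , b ⟩ 3 0 K (↝-≡ (cong (λ z → ⟨ z , K ⟩) (π₂-⟨⟩ a b)))
  -- The oracle is `𝟎`, and `execute` answers 0 on tag 4.
  runs {x = x} oracle K = ↝-push x 4 0 K ↝-refl
  runs {x = x} (pair {c} {d} {a = a} {b} p q) K =
    ↝-push x 5 ⟨ ⌜ c ⌝ , ⌜ d ⌝ ⟩ K
      (↝-trans (↝-≡ (cong₂ (λ y z → ⟨ x , push y (push ⟨ 9 , ⟨ x , z ⟩ ⟩ K) ⟩) (π₁-⟨⟩ ⌜ c ⌝ ⌜ d ⌝) (π₂-⟨⟩ ⌜ c ⌝ ⌜ d ⌝)))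
      (↝-trans (runs p (push ⟨ 9 , ⟨ x , ⌜ d ⌝ ⟩ ⟩ K))
      (↝-push a 9 ⟨ x , ⌜ d ⌝ ⟩ K
      (↝-trans (↝-≡ (cong₂ (λ y z → ⟨ y , push z (push ⟨ 10 , a ⟩ K) ⟩) (π₁-⟨⟩ x ⌜ d ⌝) (π₂-⟨⟩ x ⌜ d ⌝)))
      (↝-trans (runs q (push ⟨ 10 , a ⟩ K))
      (↝-push b 10 a K ↝-refl))))))
  runs {x = x} (comp {c} {d} p q) K =
    ↝-push x 6 ⟨ ⌜ c ⌝ , ⌜ d ⌝ ⟩ K
      (↝-trans (↝-≡ (cong₂ (λ y z → ⟨ x , push z (push y K) ⟩) (π₁-⟨⟩ ⌜ c ⌝ ⌜ d ⌝) (π₂-⟨⟩ ⌜ c ⌝ ⌜ d ⌝)))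
      (↝-trans (runs p (push ⌜ c ⌝ K)) (runs q K)))
  runs (prec-zero {c} {d} {a} p) K =
    ↝-push ⟨ a , 0 ⟩ 7 ⟨ ⌜ c ⌝ , ⌜ d ⌝ ⟩ K (↝-trans (↝-≡ eq) (runs p K))
    where
    eq : exec 7 ⟨ ⌜ c ⌝ , ⌜ d ⌝ ⟩ ⟨ a , 0 ⟩ K ≡ ⟨ a , push ⌜ c ⌝ K ⟩
    eq rewrite π₂-⟨⟩ a 0 | π₁-⟨⟩ a 0 | π₁-⟨⟩ ⌜ c ⌝ ⌜ d ⌝ = refl
  runs (prec-suc {c} {d} {a} {n} {r} p q) K =
    ↝-push ⟨ a , suc n ⟩ 7 ⟨ ⌜ c ⌝ , ⌜ d ⌝ ⟩ K
      (↝-trans (↝-≡ (exec-prec ⌜ c ⌝ ⌜ d ⌝ a n K))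
      (↝-trans (runs p (push ⟨ 11 , ⟨ ⟨ a , n ⟩ , ⌜ d ⌝ ⟩ ⟩ K))
      (↝-push r 11 ⟨ ⟨ a , n ⟩ , ⌜ d ⌝ ⟩ K
      (↝-trans (↝-≡ eq) (runs q K)))))
    where
    eq : exec 11 ⟨ ⟨ a , n ⟩ , ⌜ d ⌝ ⟩ r K ≡ ⟨ ⟨ a , ⟨ n , r ⟩ ⟩ , push ⌜ d ⌝ K ⟩
    eq rewrite π₁-⟨⟩ ⟨ a , n ⟩ ⌜ d ⌝ | π₂-⟨⟩ ⟨ a , n ⟩ ⌜ d ⌝ | π₁-⟨⟩ a n | π₂-⟨⟩ a n = refl
  runs (mu-found {c} {a} {n} p) K =
    ↝-push ⟨ a , n ⟩ 8 ⌜ c ⌝ K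
      (↝-trans (runs p (push ⟨ 12 , ⟨ ⌜ c ⌝ , ⟨ a , n ⟩ ⟩ ⟩ K))
      (↝-push 0 12 ⟨ ⌜ c ⌝ , ⟨ a , n ⟩ ⟩ K (↝-≡ eq)))
    where
    eq : exec 12 ⟨ ⌜ c ⌝ , ⟨ a , n ⟩ ⟩ 0 K ≡ ⟨ n , K ⟩
    eq rewrite π₂-⟨⟩ ⌜ c ⌝ ⟨ a , n ⟩ | π₂-⟨⟩ a n = refl
  runs (mu-next {c} {a} {n} {m} p q) K =
    ↝-push ⟨ a , n ⟩ 8 ⌜ c ⌝ K
      (↝-trans (runs p (push ⟨ 12 , ⟨ ⌜ c ⌝ , ⟨ a , n ⟩ ⟩ ⟩ K))
      (↝-push (suc m) 12 ⟨ ⌜ c ⌝ , ⟨ a , n ⟩ ⟩ K (↝-trans (↝-≡ eq) (runs q K))))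
    where
    eq : exec 12 ⟨ ⌜ c ⌝ , ⟨ a , n ⟩ ⟩ (suc m) K ≡ ⟨ ⟨ a , suc n ⟩ , push ⟨ 8 , ⌜ c ⌝ ⟩ K ⟩
    eq rewrite π₂-⟨⟩ ⌜ c ⌝ ⟨ a , n ⟩ | π₁-⟨⟩ ⌜ c ⌝ ⟨ a , n ⟩ | π₁-⟨⟩ a n | π₂-⟨⟩ a n = refl

-- Program `e` on its own index: only diagonal computations are simulated.
start : ℕ → ℕ
start e = ⟨ e , push e 0 ⟩

-- 0 stands for a machine that is still running.

output : ℕ → ℕ
output s = if0 (π₂ s) (suc (π₁ s)) 0

natrec-cong : ∀ z {s s′ : ℕ → ℕ} → (∀ x → s x ≡ s′ x) → ∀ n →
              natrec z (λ _ → s) n ≡ natrec z (λ _ → s′) n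
natrec-cong z eq zero    = refl
natrec-cong z {s} eq (suc n) = trans (cong s (natrec-cong z eq n)) (eq _)

opaque
  -- The approximation to `φ_e(e)` at stage `t`, shifted by one so that 0 can mean that there is no
  -- value yet.
  ψ : ℕ → ℕ → ℕ
  ψ e t = output (run (start e) t)

  ψᵗ : Tm 2
  ψᵗ = call (ifz (π₂ᵗ v0) (sucᵗ (π₁ᵗ v0)) (lit 0))
         (rec ⟪ v0 , pushᵗ v0 (lit 0) ⟫ (call stepᵗ (v0 ∷ [])) v1 ∷ [])

  ⟦ψᵗ⟧ : ∀ f e t → ⟦ ψᵗ ⟧ f (e ∷ t ∷ []) ≡ ψ e t
  ⟦ψᵗ⟧ f e t = cong output (natrec-cong (start e) (⟦stepᵗ⟧ f) t)

  -- The converse is not needed: diag is defined from ψ and not from φ.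
  ψ-complete : ∀ {e y} → φ e ⟨ e ⟩↓ y → ∃ λ t → ψ e t ≡ suc y
  ψ-complete {y = y} (c , refl , p) with t , eq ← runs p 0 = t , trans (cong output eq) halted
    where
    halted : output ⟨ y , 0 ⟩ ≡ suc y
    halted rewrite π₂-⟨⟩ y 0 | π₁-⟨⟩ y 0 = refl

  -- A state with empty stack is a fixed point of `dispatch`, whatever the instruction table.
  ψ-suc : ∀ {e y} t → ψ e t ≡ suc y → ψ e (suc t) ≡ suc y
  ψ-suc {e} t eq = halted {exec} (run (start e) t) eq
    where
    halted : ∀ {exec} s {y} → output s ≡ suc y → output (dispatch exec s) ≡ suc y
    halted s eq with π₂ s in eq₂
    ... | zero rewrite eq₂ = eq

ψ-mono : ∀ {e y t t′} → t ≤ t′ → ψ e t ≡ suc y → ψ e t′ ≡ suc y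
ψ-mono t≤t′ eq = go (≤⇒≤′ t≤t′)
  where
  go : ∀ {t′} → _ ≤′ t′ → ψ _ t′ ≡ suc _
  go ≤′-refl         = eq
  go (≤′-step t≤′t′) = ψ-suc _ (go t≤′t′)

-- Tests and finite tables

-- In tests the value 0 stands for true.

if0-≡0 : ∀ {m n} → if0 m n 1 ≡ 0 → m ≡ 0 × n ≡ 0
if0-≡0 {zero} n≡0 = refl , n≡0

if0-intro : ∀ {m n} → m ≡ 0 → n ≡ 0 → if0 m n 1 ≡ 0
if0-intro refl n≡0 = n≡0

infixr 3 _∧ᵗ_

_∧ᵗ_ : ∀ {n} → Tm n → Tm n → Tm n
t ∧ᵗ u = ifz t u (lit 1)

infixl 6 _∸ᵗ_
infix  4 _≟ᵗ_

_∸ᵗ_ : ∀ {n} → Tm n → Tm n → Tm n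
t ∸ᵗ u = rec t (predᵗ v0) u

_≟ᵗ_ : ∀ {n} → Tm n → Tm n → Tm n
t ≟ᵗ u = (t ∸ᵗ u) ∧ᵗ (u ∸ᵗ t)

natrec-∸ : ∀ m n → natrec m (λ _ → pred) n ≡ m ∸ n
natrec-∸ m zero    = refl
natrec-∸ m (suc n) = trans (cong pred (natrec-∸ m n)) (pred[m∸n]≡m∸[1+n] m n)

≟ᵗ-sound : ∀ {n f ρ} (t u : Tm n) → ⟦ t ≟ᵗ u ⟧ f ρ ≡ 0 → ⟦ t ⟧ f ρ ≡ ⟦ u ⟧ f ρ
≟ᵗ-sound {f = f} {ρ} t u eq =
  let p , q = if0-≡0 eq in
  ≤-antisym (m∸n≡0⇒m≤n (trans (sym (natrec-∸ (⟦ t ⟧ f ρ) (⟦ u ⟧ f ρ))) p))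
            (m∸n≡0⇒m≤n (trans (sym (natrec-∸ (⟦ u ⟧ f ρ) (⟦ t ⟧ f ρ))) q))

≟ᵗ-complete : ∀ {n f ρ} (t u : Tm n) → ⟦ t ⟧ f ρ ≡ ⟦ u ⟧ f ρ → ⟦ t ≟ᵗ u ⟧ f ρ ≡ 0
≟ᵗ-complete {f = f} {ρ} t u eq =
  if0-intro (trans (natrec-∸ (⟦ t ⟧ f ρ) (⟦ u ⟧ f ρ)) (m≤n⇒m∸n≡0 (≤-reflexive eq)))
            (trans (natrec-∸ (⟦ u ⟧ f ρ) (⟦ t ⟧ f ρ)) (m≤n⇒m∸n≡0 (≤-reflexive (sym eq))))

-- The values of `F` below `m` are hard-wired, so `F` itself, for instance a division, need not be
-- programmed. Beyond the table the value is 0.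
table : ∀ {n} → ℕ → (ℕ → ℕ) → Tm n → Tm n
table zero    F t = lit 0
table (suc m) F t = ifz t (lit (F 0)) (table m (F ∘ suc) (predᵗ t))

⟦table⟧ : ∀ {n f ρ} m F (t : Tm n) → ⟦ t ⟧ f ρ < m → ⟦ table m F t ⟧ f ρ ≡ F (⟦ t ⟧ f ρ)
⟦table⟧ {f = f} {ρ} (suc m) F t t<m = branch (⟦ t ⟧ f ρ) refl t<m
  where
  branch : ∀ x → ⟦ t ⟧ f ρ ≡ x → x < suc m →
           if0 x (F 0) (⟦ table m (F ∘ suc) (predᵗ t) ⟧ f ρ) ≡ F x
  branch zero    _  _         = refl
  branch (suc x) eq (s≤s x<m) =
    trans (⟦table⟧ m (F ∘ suc) (predᵗ t) (subst (_< m) (sym (cong pred eq)) x<m))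
          (cong (λ y → F (suc (pred y))) eq)

-- Digits in base k

digit : ∀ k → .{{NonZero k}} → ℕ → ℕ → ℕ
digit k zero    v = v % k
digit k (suc i) v = digit k i (v / k)

digit<k : ∀ k .{{_ : NonZero k}} i v → digit k i v < k
digit<k k zero    v = m%n<n v k
digit<k k (suc i) v = digit<k k i (v / k)

digit-injective : ∀ k .{{_ : NonZero k}} n {v v′} → v < k ^ n → v′ < k ^ n →
                  (∀ i → i < n → digit k i v ≡ digit k i v′) → v ≡ v′
digit-injective k zero    v<1 v′<1 eq = trans (n<1⇒n≡0 v<1) (sym (n<1⇒n≡0 v′<1))
digit-injective k (suc n) {v} {v′} v< v′< eq =
  trans (m≡m%n+[m/n]*n v k)
    (trans (cong₂ (λ r q → r + q * k) (eq 0 z<s)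
             (digit-injective k n (m<n*o⇒m/o<n (subst (v <_) (*-comm k (k ^ n)) v<))
                                  (m<n*o⇒m/o<n (subst (v′ <_) (*-comm k (k ^ n)) v′<))
                                  (λ i i<n → eq (suc i) (s<s i<n))))
           (sym (m≡m%n+[m/n]*n v′ k)))

-- The s-m-n theorem

pairᵗ compᵗ : ∀ {n} → Tm n → Tm n → Tm n
pairᵗ t u = ⟪ lit 5 , ⟪ t , u ⟫ ⟫
compᵗ t u = ⟪ lit 6 , ⟪ t , u ⟫ ⟫

constᵗ : ∀ {n} → Tm n → Tm n
constᵗ t = rec (lit ⌜ zero ⌝) (compᵗ (lit ⌜ succ ⌝) v0) t

⟦pairᵗ⟧ : ∀ {n} f (ρ : Vec ℕ n) t u c d → ⟦ t ⟧ f ρ ≡ ⌜ c ⌝ → ⟦ u ⟧ f ρ ≡ ⌜ d ⌝ →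
          ⟦ pairᵗ t u ⟧ f ρ ≡ ⌜ pair c d ⌝
⟦pairᵗ⟧ f ρ t u c d = cong₂ (λ x y → ⟨ 5 , ⟨ x , y ⟩ ⟩)

⟦compᵗ⟧ : ∀ {n} f (ρ : Vec ℕ n) t u c d → ⟦ t ⟧ f ρ ≡ ⌜ c ⌝ → ⟦ u ⟧ f ρ ≡ ⌜ d ⌝ →
          ⟦ compᵗ t u ⟧ f ρ ≡ ⌜ comp c d ⌝
⟦compᵗ⟧ f ρ t u c d = cong₂ (λ x y → ⟨ 6 , ⟨ x , y ⟩ ⟩)

⟦constᵗ⟧ : ∀ {n f} {ρ : Vec ℕ n} (t : Tm n) → ⟦ constᵗ t ⟧ f ρ ≡ ⌜ const (⟦ t ⟧ f ρ) ⌝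
⟦constᵗ⟧ {f = f} {ρ} t = loop (⟦ t ⟧ f ρ)
  where
  loop : ∀ n → natrec ⌜ zero ⌝ (λ _ r → ⟨ 6 , ⟨ ⌜ succ ⌝ , r ⟩ ⟩) n ≡ ⌜ const n ⌝
  loop zero    = refl
  loop (suc n) = cong (λ r → ⟨ 6 , ⟨ ⌜ succ ⌝ , r ⟩ ⟩) (loop n)

-- The inner program turns the input `x` into `env (x ∷ a ∷ [])`, with `a` stored as a constant.
specialize : Code → ℕ → Code
specialize c a = comp c (pair (pair zero (const a)) idᶜ)

⇓-specialize : ∀ {f c a x y} → f ⊢ c · env (x ∷ a ∷ []) ⇓ y → f ⊢ specialize c a · x ⇓ y
⇓-specialize {a = a} {x} p = comp (pair (pair zero (⇓-const a)) (⇓-id x)) p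

-- Opaque, so that ⌜ c ⌝ is never evaluated to a numeral.

opaque
  smn : Code → ℕ → ℕ
  smn c a = ⌜ specialize c a ⌝

  smn-⌜⌝ : ∀ c a → smn c a ≡ ⌜ specialize c a ⌝
  smn-⌜⌝ c a = refl

  smnᵗ : ∀ {n} → Code → Tm n → Tm n
  smnᵗ c t = compᵗ (lit ⌜ c ⌝) (pairᵗ (pairᵗ (lit ⌜ zero ⌝) (constᵗ t)) (lit ⌜ idᶜ ⌝))

  ⟦smnᵗ⟧ : ∀ {n f} {ρ : Vec ℕ n} c (t : Tm n) → ⟦ smnᵗ c t ⟧ f ρ ≡ smn c (⟦ t ⟧ f ρ)
  ⟦smnᵗ⟧ {n} {f} {ρ} c t =
    ⟦compᵗ⟧ f ρ (lit ⌜ c ⌝) (pairᵗ args (lit ⌜ idᶜ ⌝)) c (pair argsᶜ idᶜ) refl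
      (⟦pairᵗ⟧ f ρ args (lit ⌜ idᶜ ⌝) argsᶜ idᶜ
        (⟦pairᵗ⟧ f ρ (lit ⌜ zero ⌝) (constᵗ t) zero (const a) refl (⟦constᵗ⟧ t)) refl)
    where
    a : ℕ
    a = ⟦ t ⟧ f ρ

    args : Tm n
    args = pairᵗ (lit ⌜ zero ⌝) (constᵗ t)

    argsᶜ : Code
    argsᶜ = pair zero (const a)

Φ-smn : ∀ {f c a x y} → f ⊢ c · env (x ∷ a ∷ []) ⇓ y → Φ smn c a ⟨ f ⟩ x ↓ y
Φ-smn {c = c} {a} p = specialize c a , sym (smn-⌜⌝ c a) , ⇓-specialize p

-- Codes of initial segments

drop : ℕ → ℕ → ℕ
drop i s = natrec s (λ _ r → π₂ (pred r)) i

drop-suc : ∀ i x s → drop (suc i) (suc ⟨ x , s ⟩) ≡ drop i s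
drop-suc zero    x s = π₂-⟨⟩ x s
drop-suc (suc i) x s = cong (π₂ ∘ pred) (drop-suc i x s)

drop-[] : ∀ i → drop i 0 ≡ 0
drop-[] zero = refl
drop-[] (suc i) rewrite drop-[] i = π₂-⟨⟩ 0 0

drop-< : ∀ f {i n} → i < n → ∃ λ s → drop i ⌜ f ↾ n ⌝* ≡ suc ⟨ f i , s ⟩
drop-< f {zero}  {suc n} _         = _ , refl
drop-< f {suc i} {suc n} (s≤s i<n) =
  let s , eq = drop-< (f ∘ suc) i<n in s , trans (drop-suc i (f 0) ⌜ (f ∘ suc) ↾ n ⌝*) eq

-- The code 0 of the empty list is its own tail, so the result 0 signals a segment too short to have
-- an entry at place `i`.
drop-≥ : ∀ f {i n} → n ≤ i → drop i ⌜ f ↾ n ⌝* ≡ 0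
drop-≥ f {i} {zero} _ = drop-[] i
drop-≥ f {suc i} {suc n} (s≤s n≤i) =
  trans (drop-suc i (f 0) ⌜ (f ∘ suc) ↾ n ⌝*) (drop-≥ (f ∘ suc) n≤i)

-- Thus the code of a segment can itself bound the searches through that segment.
n≤⌜↾⌝ : ∀ f n → n ≤ ⌜ f ↾ n ⌝*
n≤⌜↾⌝ f zero    = z≤n
n≤⌜↾⌝ f (suc n) = s≤s (≤-trans (n≤⌜↾⌝ (f ∘ suc) n) (m≤n+m _ (triangle (f 0 + ⌜ (f ∘ suc) ↾ n ⌝*))))

-- The entry `(w)ᵢ` of the sequence read off from `w` is `π₁ (tail i w)`.
tail : ℕ → ℕ → ℕ
tail zero    w = w
tail (suc i) w = π₂ (tail i w)

tailᵗ : ∀ {n} → ℕ → Tm n → Tm n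
tailᵗ zero    t = t
tailᵗ (suc i) t = π₂ᵗ (tailᵗ i t)

⟦tailᵗ⟧ : ∀ {n f} {ρ : Vec ℕ n} i t → ⟦ tailᵗ i t ⟧ f ρ ≡ tail i (⟦ t ⟧ f ρ)
⟦tailᵗ⟧ zero    t = refl
⟦tailᵗ⟧ (suc i) t = cong π₂ (⟦tailᵗ⟧ i t)

-- Bounded search, learners from terms, common bounds

anyBelow : (ℕ → ℕ) → ℕ → ℕ
anyBelow P = natrec 1 (λ i r → if0 (P i) 0 r)

anyBelow-sound : ∀ P m → anyBelow P m ≡ 0 → ∃ λ i → P i ≡ 0
anyBelow-sound P (suc m) eq with P m in eqₘ
... | zero  = m , eqₘ
... | suc _ = anyBelow-sound P m eq

anyBelow-complete : ∀ P {m i} → i < m → P i ≡ 0 → anyBelow P m ≡ 0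
anyBelow-complete P {suc m} {i} (s≤s i≤m) eq with m≤n⇒m<n∨m≡n i≤m
... | inj₂ refl rewrite eq = refl
... | inj₁ i<m with P m
...   | zero  = refl
...   | suc _ = anyBelow-complete P i<m eq

-- The value moves from `r` to `r + 1` only while `R r` is 0, so it rests at the first failure of
-- `R`. The last argument limits the number of moves.
leastBelow : (ℕ → ℕ) → ℕ → ℕ
leastBelow R = natrec 0 (λ _ r → if0 (R r) (suc r) r)

leastBelow-≡ : ∀ R {a m} → (∀ a′ → a′ < a → R a′ ≡ 0) → R a ≢ 0 → a ≤ m → leastBelow R m ≡ a
leastBelow-≡ R {a} below Ra≢0 a≤m = stay (≤⇒≤′ a≤m)
  where
  climb : ∀ i → i ≤ a → leastBelow R i ≡ i
  climb zero    _   = refl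
  climb (suc i) i<a rewrite climb i (<⇒≤ i<a) | below i i<a = refl

  stay : ∀ {m} → a ≤′ m → leastBelow R m ≡ a
  stay ≤′-refl = climb a ≤-refl
  stay (≤′-step a≤′m) rewrite stay a≤′m with R a
  ... | zero  = ⊥-elim (Ra≢0 refl)
  ... | suc _ = refl

learner : Tm 1 → Learner
learner t = record
  { fun      = λ σ → ⟦ t ⟧ 𝟎 (⌜ σ ⌝* ∷ [])
  ; index    = ⌜ comp (compile t) (pair zero idᶜ) ⌝
  ; computes = λ σ → comp (compile t) (pair zero idᶜ) , refl ,
                     comp (pair zero (⇓-id ⌜ σ ⌝*)) (⇓-compile t (⌜ σ ⌝* ∷ []))
  }

-- The maximum of the `n` given bounds works, since each `P i` is upward closed.
collect : ∀ {P : ℕ → ℕ → Set} → (∀ {i b b′} → b ≤ b′ → P i b → P i b′) →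
          ∀ n → (∀ i → i < n → ∃ (P i)) → ∃ λ b → ∀ i → i < n → P i b
collect mono zero    p = 0 , λ _ ()
collect {P} mono (suc n) p =
  let b , q = collect {P} mono n (λ i i<n → p i (m<n⇒m<1+n i<n))
      c , r = p n ≤-refl
  in b ⊔ c , λ i i<1+n →
       [ (λ i<n → mono (m≤m⊔n b c) (q i i<n))
       , (λ { refl → mono (m≤n⊔m b c) r }) ]′ (m<1+n⇒m<n∨m≡n i<1+n)

-- Values below kⁿ as n-tuples, and the diagonal program q

module Tuples (k n : ℕ) .{{_ : NonZero k}} where

  K : ℕ
  K = k ^ n

  Match : ℕ → ℕ → ℕ → ℕ → Set
  Match j v w t = ∀ i → i < j → ψ (π₁ (tail i w)) t ≡ suc (digit k i v)

  Match-suc : ∀ {j v w t} → Match j v w t → ψ (π₁ (tail j w)) t ≡ suc (digit k j v) →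
              Match (suc j) v w t
  Match-suc match eq i (s≤s i≤j) with m≤n⇒m<n∨m≡n i≤j
  ... | inj₁ i<j  = match i i<j
  ... | inj₂ refl = eq

  Match-mono : ∀ {j v w t t′} → t ≤ t′ → Match j v w t → Match j v w t′
  Match-mono t≤t′ match i i<j = ψ-mono t≤t′ (match i i<j)

  -- The successor of the digit if t is below K, and 0 otherwise.

  digitᵗ : ∀ {m} → ℕ → Tm m → Tm m
  digitᵗ i t = table K (suc ∘ digit k i) t

  coordᵗ : ℕ → Tm 3
  coordᵗ i = call ψᵗ (π₁ᵗ (tailᵗ i v1) ∷ v2 ∷ [])

  ⟦coordᵗ⟧ : ∀ f v w t i → ⟦ coordᵗ i ⟧ f (v ∷ w ∷ t ∷ []) ≡ ψ (π₁ (tail i w)) t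
  ⟦coordᵗ⟧ f v w t i =
    trans (⟦ψᵗ⟧ f _ t) (cong (λ z → ψ (π₁ z) t) (⟦tailᵗ⟧ {f = f} {v ∷ w ∷ t ∷ []} i v1))

  matchᵗ : ℕ → Tm 3
  matchᵗ zero    = lit 0
  matchᵗ (suc j) = matchᵗ j ∧ᵗ (coordᵗ j ≟ᵗ digitᵗ j v0)

  matchᵗ-sound : ∀ {f v w t} j → v < K → ⟦ matchᵗ j ⟧ f (v ∷ w ∷ t ∷ []) ≡ 0 → Match j v w t
  matchᵗ-sound zero v<K eq _ ()
  matchᵗ-sound {f} {v} {w} {t} (suc j) v<K eq =
    let p , q = if0-≡0 eq in
    Match-suc {j} {v} {w} {t} (matchᵗ-sound j v<K p)
      (trans (sym (⟦coordᵗ⟧ f v w t j))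
        (trans (≟ᵗ-sound (coordᵗ j) (digitᵗ j v0) q)
          (⟦table⟧ {f = f} {v ∷ w ∷ t ∷ []} K (suc ∘ digit k j) v0 v<K)))

  matchᵗ-complete : ∀ {f v w t} j → v < K → Match j v w t → ⟦ matchᵗ j ⟧ f (v ∷ w ∷ t ∷ []) ≡ 0
  matchᵗ-complete zero v<K match = refl
  matchᵗ-complete {f} {v} {w} {t} (suc j) v<K match =
    if0-intro (matchᵗ-complete j v<K (λ i i<j → match i (m<n⇒m<1+n i<j)))
      (≟ᵗ-complete (coordᵗ j) (digitᵗ j v0)
        (trans (⟦coordᵗ⟧ f v w t j)
          (trans (match j ≤-refl)
            (sym (⟦table⟧ {f = f} {v ∷ w ∷ t ∷ []} K (suc ∘ digit k j) v0 v<K)))))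

  -- The variables are ⟨ v , t ⟩, an ignored input, and w.

  diagTest : Tm 3
  diagTest = (sucᵗ (π₁ᵗ v0) ∸ᵗ lit K) ∧ᵗ call (matchᵗ n) (π₁ᵗ v0 ∷ v2 ∷ π₂ᵗ v0 ∷ [])

  diag : Code
  diag = search diagTest (π₁ᵗ v0)

  q : ℕ → ℕ
  q = smn diag

  qᵗ : ∀ {m} → Tm m → Tm m
  qᵗ = smnᵗ diag

  -- The search may stop at another pair than `⟨ v , t ⟩`. By `ψ-mono` both tuples show the same
  -- digits at a common later stage, and both are below `K`, so they are equal.
  φ-q : ∀ {v w t} x → v < K → Match n v w t → φ q w ⟨ x ⟩↓ v
  φ-q {v} {w} {t} x v<K match with
    ⇓-search {f = 𝟎} diagTest (π₁ᵗ v0) (x ∷ w ∷ []) {⟨ v , t ⟩} complete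
    where
    complete : ⟦ diagTest ⟧ 𝟎 (⟨ v , t ⟩ ∷ x ∷ w ∷ []) ≡ 0
    complete rewrite π₁-⟨⟩ v t | π₂-⟨⟩ v t =
      if0-intro (trans (natrec-∸ (suc v) K) (m≤n⇒m∸n≡0 v<K)) (matchᵗ-complete n v<K match)
  ... | u , eq , p = subst (φ q w ⟨ x ⟩↓_) π₁u≡v (Φ-smn p)
    where
    π₁u<K : π₁ u < K
    π₁u<K = m∸n≡0⇒m≤n (trans (sym (natrec-∸ (suc (π₁ u)) K)) (proj₁ (if0-≡0 eq)))

    match′ : Match n (π₁ u) w (π₂ u)
    match′ = matchᵗ-sound n π₁u<K (proj₂ (if0-≡0 {natrec (suc (π₁ u)) (λ _ → pred) K} eq))

    π₁u≡v : π₁ u ≡ v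
    π₁u≡v = digit-injective k n π₁u<K v<K λ i i<n → suc-injective
      (trans (sym (Match-mono {n} {π₁ u} {w} (m≤n⊔m t (π₂ u)) match′ i i<n))
             (Match-mono {n} {v} {w} (m≤m⊔n t (π₂ u)) match i i<n))

  -- Refuted numbers and the functionals `pick`

  Good : ℕ → Baire → ℕ → ℕ → Set
  Good j g b u = tail j (π₁ u) ≡ b × Match j (g (q (π₁ u))) (π₁ u) (π₂ u)

  -- An `a` that is not refuted at level `suc j` is safe advice for `pick j`, by `refuted-suc`;
  -- refutation of every number at level `j` makes the search of `pick j` succeed.
  Refuted : ℕ → Baire → ℕ → Set
  Refuted j g b = ∃ (Good j g b)

  -- The variables are ⟨ w , t ⟩, e and a.

  pickTest pickOut : ℕ → Tm 3
  pickTest j = (tailᵗ j (π₁ᵗ v0) ≟ᵗ ⟪ v1 , v2 ⟫) ∧ᵗ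
               call (matchᵗ j) (oracleᵗ (qᵗ (π₁ᵗ v0)) ∷ π₁ᵗ v0 ∷ π₂ᵗ v0 ∷ [])
  pickOut j = predᵗ (digitᵗ j (oracleᵗ (qᵗ (π₁ᵗ v0))))

  pick : ℕ → Code
  pick j = search (pickTest j) (pickOut j)

  ⟦oracle-q⟧ : ∀ f u e a → ⟦ oracleᵗ (qᵗ (π₁ᵗ v0)) ⟧ f (u ∷ e ∷ a ∷ []) ≡ f (q (π₁ u))
  ⟦oracle-q⟧ f u e a = cong f (⟦smnᵗ⟧ {f = f} {u ∷ e ∷ a ∷ []} diag (π₁ᵗ v0))

  pickTest-sound : ∀ {g e a u} j → (∀ x → g x < K) →
                   ⟦ pickTest j ⟧ g (u ∷ e ∷ a ∷ []) ≡ 0 → Good j g ⟨ e , a ⟩ u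
  pickTest-sound {g} {e} {a} {u} j g<K eq =
    trans (sym (⟦tailᵗ⟧ {f = g} {u ∷ e ∷ a ∷ []} j (π₁ᵗ v0)))
          (≟ᵗ-sound {f = g} {u ∷ e ∷ a ∷ []} (tailᵗ j (π₁ᵗ v0)) ⟪ v1 , v2 ⟫ (proj₁ both)) ,
    matchᵗ-sound j (g<K _)
      (subst (λ z → ⟦ matchᵗ j ⟧ g (z ∷ π₁ u ∷ π₂ u ∷ []) ≡ 0) (⟦oracle-q⟧ g u e a) (proj₂ both))
    where
    both = if0-≡0 {⟦ tailᵗ j (π₁ᵗ v0) ≟ᵗ ⟪ v1 , v2 ⟫ ⟧ g (u ∷ e ∷ a ∷ [])} eq

  pickTest-tail : ∀ {g e a u} j → tail j (π₁ u) ≡ ⟨ e , a ⟩ →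
                  ⟦ tailᵗ j (π₁ᵗ v0) ≟ᵗ ⟪ v1 , v2 ⟫ ⟧ g (u ∷ e ∷ a ∷ []) ≡ 0
  pickTest-tail {g} {e} {a} {u} j eq =
    ≟ᵗ-complete {f = g} {u ∷ e ∷ a ∷ []} (tailᵗ j (π₁ᵗ v0)) ⟪ v1 , v2 ⟫
      (trans (⟦tailᵗ⟧ {f = g} {u ∷ e ∷ a ∷ []} j (π₁ᵗ v0)) eq)

  pickTest-complete : ∀ {g e a u} j → (∀ x → g x < K) → Good j g ⟨ e , a ⟩ u →
                      ⟦ pickTest j ⟧ g (u ∷ e ∷ a ∷ []) ≡ 0
  pickTest-complete {g} {e} {a} {u} j g<K (tail≡ , match) =
    if0-intro (pickTest-tail {g} {e} {a} {u} j tail≡)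
      (subst (λ z → ⟦ matchᵗ j ⟧ g (z ∷ π₁ u ∷ π₂ u ∷ []) ≡ 0) (sym (⟦oracle-q⟧ g u e a))
        (matchᵗ-complete j (g<K _) match))

  Φ-pick : ∀ {g e a} j → (∀ x → g x < K) → Refuted j g ⟨ e , a ⟩ →
           ∃ λ u → Good j g ⟨ e , a ⟩ u × Φ smn (pick j) a ⟨ g ⟩ e ↓ digit k j (g (q (π₁ u)))
  Φ-pick {g} {e} {a} j g<K (_ , good) =
    let u , eq , p = ⇓-search {f = g} (pickTest j) (pickOut j) (e ∷ a ∷ [])
                       (pickTest-complete j g<K good)
    in u , pickTest-sound j g<K eq ,
       Φ-smn (subst (g ⊢ pick j · env (e ∷ a ∷ []) ⇓_) (out u) p)
    where
    out : ∀ u → ⟦ pickOut j ⟧ g (u ∷ e ∷ a ∷ []) ≡ digit k j (g (q (π₁ u)))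
    out u = trans
      (cong pred (⟦table⟧ {f = g} {u ∷ e ∷ a ∷ []} K (suc ∘ digit k j) (oracleᵗ (qᵗ (π₁ᵗ v0))) (g<K _)))
      (cong (digit k j) (⟦oracle-q⟧ g u e a))

  -- At level 0 no digit has to match, so `w = ⟨ e , a ⟩` passes the test for every oracle, even one
  -- with values outside the range below `K`.
  Total-pick₀ : ∀ f a → Total (smn (pick 0) a) f
  Total-pick₀ f a e =
    let _ , _ , p = ⇓-search {f = f} (pickTest 0) (pickOut 0) (e ∷ a ∷ []) {⟨ ⟨ e , a ⟩ , 0 ⟩}
                      (if0-intro (pickTest-tail {f} {e} {a} {⟨ ⟨ e , a ⟩ , 0 ⟩} 0 (π₁-⟨⟩ ⟨ e , a ⟩ 0)) refl)
    in _ , Φ-smn p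

  -- Learning the least number that is not refuted

  -- The variables are ⟨ w , t ⟩, a and the code of an initial segment of g.

  refuteᵗ : ℕ → Tm 3
  -- Inside the call, `v0` is the part of the segment from place `q(w)` on. If it is 0, the value
  -- `g(q(w))` is still unknown and the test fails.
  refuteᵗ j = call (ifz v0 (lit 1) ((tailᵗ j (π₁ᵗ v1) ≟ᵗ v2) ∧ᵗ
                      call (matchᵗ j) (π₁ᵗ (predᵗ v0) ∷ π₁ᵗ v1 ∷ π₂ᵗ v1 ∷ [])))
                   (rec v2 (π₂ᵗ (predᵗ v0)) (qᵗ (π₁ᵗ v0)) ∷ v0 ∷ v1 ∷ [])

  refuteBody : ℕ → ℕ → ℕ → ℕ → ℕ
  refuteBody j d u a = if0 d 1 (if0 (⟦ tailᵗ j (π₁ᵗ v1) ≟ᵗ v2 ⟧ 𝟎 (d ∷ u ∷ a ∷ []))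
                                    (⟦ matchᵗ j ⟧ 𝟎 (π₁ (pred d) ∷ π₁ u ∷ π₂ u ∷ [])) 1)

  ⟦refuteᵗ⟧ : ∀ j u a s → ⟦ refuteᵗ j ⟧ 𝟎 (u ∷ a ∷ s ∷ []) ≡
              refuteBody j (drop (q (π₁ u)) s) u a
  ⟦refuteᵗ⟧ j u a s =
    cong (λ i → refuteBody j (drop i s) u a) (⟦smnᵗ⟧ {f = 𝟎} {u ∷ a ∷ s ∷ []} diag (π₁ᵗ v0))

  refuteᵗ-sound : ∀ {g} m j {u a} → (∀ x → g x < K) →
                  ⟦ refuteᵗ j ⟧ 𝟎 (u ∷ a ∷ ⌜ g ↾ m ⌝* ∷ []) ≡ 0 → Good j g a u
  refuteᵗ-sound {g} m j {u} {a} g<K eq with q (π₁ u) <? m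
  ... | no q≮m with () ← trans (sym (cong (λ d → refuteBody j d u a) (drop-≥ g (≮⇒≥ q≮m))))
                               (trans (sym (⟦refuteᵗ⟧ j u a _)) eq)
  ... | yes q<m with drop-< g q<m
  ...   | s , eqₛ with if0-≡0 {⟦ tailᵗ j (π₁ᵗ v1) ≟ᵗ v2 ⟧ 𝟎 (suc ⟨ g (q (π₁ u)) , s ⟩ ∷ u ∷ a ∷ [])}
                     (trans (sym (cong (λ d → refuteBody j d u a) eqₛ))
                            (trans (sym (⟦refuteᵗ⟧ j u a _)) eq))
  ...     | p , r =
    trans (sym (⟦tailᵗ⟧ {f = 𝟎} {suc ⟨ g (q (π₁ u)) , s ⟩ ∷ u ∷ a ∷ []} j (π₁ᵗ v1)))
          (≟ᵗ-sound {f = 𝟎} {suc ⟨ g (q (π₁ u)) , s ⟩ ∷ u ∷ a ∷ []} (tailᵗ j (π₁ᵗ v1)) v2 p) ,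
    matchᵗ-sound j (g<K _)
      (subst (λ z → ⟦ matchᵗ j ⟧ 𝟎 (z ∷ π₁ u ∷ π₂ u ∷ []) ≡ 0) (π₁-⟨⟩ (g (q (π₁ u))) s) r)

  refuteᵗ-complete : ∀ {g} m j {u a} → (∀ x → g x < K) → q (π₁ u) < m → Good j g a u →
                     ⟦ refuteᵗ j ⟧ 𝟎 (u ∷ a ∷ ⌜ g ↾ m ⌝* ∷ []) ≡ 0
  refuteᵗ-complete {g} m j {u} {a} g<K q<m (tail≡ , match) =
    let s , eqₛ = drop-< g q<m
        ρ       = suc ⟨ g (q (π₁ u)) , s ⟩ ∷ u ∷ a ∷ []
    in trans (⟦refuteᵗ⟧ j u a _) (trans (cong (λ d → refuteBody j d u a) eqₛ)
      (if0-intro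
        (≟ᵗ-complete {f = 𝟎} {ρ} (tailᵗ j (π₁ᵗ v1)) v2
          (trans (⟦tailᵗ⟧ {f = 𝟎} {ρ} j (π₁ᵗ v1)) tail≡))
        (subst (λ z → ⟦ matchᵗ j ⟧ 𝟎 (z ∷ π₁ u ∷ π₂ u ∷ []) ≡ 0) (sym (π₁-⟨⟩ (g (q (π₁ u))) s))
          (matchᵗ-complete j (g<K _) match))))

  -- The variables are `a` and the code of the segment, which also bounds the search for `u`.
  refutedᵗ : ℕ → Tm 2
  refutedᵗ j = rec (lit 1) (ifz (call (refuteᵗ j) (v1 ∷ v2 ∷ v3 ∷ [])) (lit 0) v0) v1

  guessᵗ : ℕ → Tm 1
  guessᵗ j = rec (lit 0) (ifz (call (refutedᵗ j) (v0 ∷ v2 ∷ [])) (sucᵗ v0) v0) v0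

  -- Each of the finitely many `a′ < a` is refuted by some finite segment of `g`, while soundness of
  -- the test keeps `a` from ever being rejected.
  guess-limit : ∀ {g a} j → (∀ x → g x < K) → ¬ Refuted j g a → (∀ a′ → a′ < a → Refuted j g a′) →
                ∃ λ N → ∀ m → N ≤ m → ⟦ guessᵗ j ⟧ 𝟎 (⌜ g ↾ m ⌝* ∷ []) ≡ a
  guess-limit {g} {a} j g<K unrefuted below =
    let b , seen = collect {Seen} (λ b≤b′ (u , u<b , q<b , good) →
                     u , <-≤-trans u<b b≤b′ , <-≤-trans q<b b≤b′ , good)
                     a (λ a′ a′<a → let u , good = below a′ a′<a in
                       suc (u + q (π₁ u)) , u , s≤s (m≤m+n u _) , s≤s (m≤n+m _ u) , good)
    -- From `b` on all `a′ < a` are seen refuted; from `a` on the guess has enough moves to reach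
    -- `a`.
    in a ⊔ b , λ m N≤m → leastBelow-≡ (λ a′ → ⟦ refutedᵗ j ⟧ 𝟎 (a′ ∷ ⌜ g ↾ m ⌝* ∷ []))
         (λ a′ a′<a →
           let u , u<b , q<b , good = seen a′ a′<a
               b≤m = ≤-trans (m≤n⊔m a b) N≤m
           in anyBelow-complete (λ u → ⟦ refuteᵗ j ⟧ 𝟎 (u ∷ a′ ∷ ⌜ g ↾ m ⌝* ∷ []))
                (<-≤-trans u<b (≤-trans b≤m (n≤⌜↾⌝ g m)))
                (refuteᵗ-complete m j g<K (<-≤-trans q<b b≤m) good))
         (λ eq → let u , eqᵤ = anyBelow-sound (λ u → ⟦ refuteᵗ j ⟧ 𝟎 (u ∷ a ∷ ⌜ g ↾ m ⌝* ∷ [])) ⌜ g ↾ m ⌝* eq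
                 in unrefuted (u , refuteᵗ-sound m j g<K eqᵤ))
         (≤-trans (≤-trans (m≤m⊔n a b) N≤m) (n≤⌜↾⌝ g m))
    where
    Seen : ℕ → ℕ → Set
    Seen a′ b = ∃ λ u → u < b × q (π₁ u) < b × Good j g a′ u

  guesser : ℕ → Learner
  guesser j = learner (smnᵗ (pick j) (guessᵗ (suc j)))

  guesser-fun : ∀ j σ → fun (guesser j) σ ≡ smn (pick j) (⟦ guessᵗ (suc j) ⟧ 𝟎 (⌜ σ ⌝* ∷ []))
  guesser-fun j σ = ⟦smnᵗ⟧ {f = 𝟎} {⌜ σ ⌝* ∷ []} (pick j) (guessᵗ (suc j))

  -- A limit is one of the learner's values, hence `smn (pick 0) a` for some `a`, and all of these
  -- indices are total on every oracle.
  guesser₀-eventuallyPopperian : EventuallyPopperian (guesser 0)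
  guesser₀-eventuallyPopperian f (N , eq) =
    subst (λ ℓ → Total ℓ f) (trans (sym (guesser-fun 0 (f ↾ N))) (eq N ≤-refl)) (Total-pick₀ f _)

  guesser-lim : ∀ {g a} j → (∀ x → g x < K) → ¬ Refuted (suc j) g a →
                (∀ a′ → a′ < a → Refuted (suc j) g a′) → Lim guesser j ⟨ g ⟩≡ smn (pick j) a
  guesser-lim {g} j g<K unrefuted below =
    let N , eq = guess-limit (suc j) g<K unrefuted below in
    N , λ m N≤m → trans (guesser-fun j (g ↾ m)) (cong (smn (pick j)) (eq m N≤m))

  -- Unrefuted numbers yield elements of DNR k

  refuted₀ : ∀ g b → Refuted 0 g b
  refuted₀ g b = ⟨ b , 0 ⟩ , π₁-⟨⟩ b 0 , λ _ ()

  -- If all `n` digits of `g(q(w))` matched, program `q(w)` would output `g(q(w))` on input `q(w)`,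
  -- against diagonal noncomputability of `g`.
  unrefutedₙ : ∀ {g} → g ∈ DNR K → ∀ a → ¬ Refuted n g a
  unrefutedₙ {g} (g<K , dnr) a (u , _ , match) = dnr (φ-q (q (π₁ u)) (g<K _) match) refl

  good-⟨⟩ : ∀ {j g b w t} → tail j w ≡ b → Match j (g (q w)) w t → Good j g b ⟨ w , t ⟩
  good-⟨⟩ {j} {g} {b} {w} {t} tail≡ match =
    trans (cong (tail j) (π₁-⟨⟩ w t)) tail≡ ,
    subst₂ (λ w′ t′ → Match j (g (q w′)) w′ t′) (sym (π₁-⟨⟩ w t)) (sym (π₂-⟨⟩ w t)) match

  -- As `tail j w` is `⟨ e , a ⟩`, the next argument in `w` is `e`. If digit `j` is its diagonal
  -- value, one more digit matches and the remaining tail is `a`.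
  refuted-suc : ∀ {j g e a u t} → Good j g ⟨ e , a ⟩ u →
                ψ e t ≡ suc (digit k j (g (q (π₁ u)))) → Refuted (suc j) g a
  refuted-suc {j} {g} {e} {a} {u} {t} (tail≡ , match) ψ≡ =
    ⟨ w , t ⊔ π₂ u ⟩ ,
    good-⟨⟩ {suc j} {g} {a} {w} (trans (cong π₂ tail≡) (π₂-⟨⟩ e a))
      (Match-suc {j} {v} {w} (Match-mono {j} {v} {w} (m≤n⊔m t (π₂ u)) match)
        (trans (cong (λ e → ψ e (t ⊔ π₂ u)) (trans (cong π₁ tail≡) (π₁-⟨⟩ e a)))
               (ψ-mono (m≤m⊔n t (π₂ u)) ψ≡)))
    where
    w v : ℕ
    w = π₁ u
    v = g (q w)

  pick-DNR : ∀ {g a} j → g ∈ DNR K → ¬ Refuted (suc j) g a → (∀ b → Refuted j g b) →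
             ∃ λ h → Φ smn (pick j) a ⟨ g ⟩↓ h × h ∈ DNR k
  pick-DNR {g} {a} j (g<K , dnr) unrefuted refuted =
    (λ e → digit k j (g (q (π₁ (w e))))) , (λ e → proj₂ (proj₂ (found e))) ,
    (λ e → digit<k k j _) , avoid
    where
    found : ∀ e → ∃ λ u → Good j g ⟨ e , a ⟩ u ×
                          Φ smn (pick j) a ⟨ g ⟩ e ↓ digit k j (g (q (π₁ u)))
    found e = Φ-pick j g<K (refuted ⟨ e , a ⟩)

    w : ℕ → ℕ
    w e = proj₁ (found e)

    avoid : ∀ {e y} → φ e ⟨ e ⟩↓ y → digit k j (g (q (π₁ (w e)))) ≢ y
    avoid {e} p eq =
      let t , ψ≡ = ψ-complete p
      in unrefuted (refuted-suc {j} {g} {e} {a} {w e} (proj₁ (proj₂ (found e))) (trans ψ≡ (cong suc (sym eq))))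

-- Invariance under pointwise equality, and simple reductions

applyUpTo-cong : ∀ {f g : Baire} → f ≗ g → ∀ n → f ↾ n ≡ g ↾ n
applyUpTo-cong f≗g zero    = refl
applyUpTo-cong f≗g (suc n) = cong₂ _∷_ (f≗g 0) (applyUpTo-cong (f≗g ∘ suc) n)

⇓-respects-≗ : ∀ {f g c x y} → f ≗ g → f ⊢ c · x ⇓ y → g ⊢ c · x ⇓ y
⇓-respects-≗ f≗g zero = zero
⇓-respects-≗ f≗g succ = succ
⇓-respects-≗ f≗g (fst {a} {b}) = fst {a = a} {b}
⇓-respects-≗ f≗g (snd {a} {b}) = snd {a = a} {b}
⇓-respects-≗ {g = g} f≗g (oracle {x}) = subst (g ⊢ oracle · x ⇓_) (sym (f≗g x)) oracle
⇓-respects-≗ f≗g (pair p q) = pair (⇓-respects-≗ f≗g p) (⇓-respects-≗ f≗g q)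
⇓-respects-≗ f≗g (comp p q) = comp (⇓-respects-≗ f≗g p) (⇓-respects-≗ f≗g q)
⇓-respects-≗ f≗g (prec-zero {a = a} p) = prec-zero {a = a} (⇓-respects-≗ f≗g p)
⇓-respects-≗ f≗g (prec-suc {a = a} {n} p q) =
  prec-suc {a = a} {n} (⇓-respects-≗ f≗g p) (⇓-respects-≗ f≗g q)
⇓-respects-≗ f≗g (mu-found {a = a} {n} p) = mu-found {a = a} {n} (⇓-respects-≗ f≗g p)
⇓-respects-≗ f≗g (mu-next {a = a} {n} p q) =
  mu-next {a = a} {n} (⇓-respects-≗ f≗g p) (⇓-respects-≗ f≗g q)

Learns-respects-≗ : ∀ {Ψ g g′ h h′} → g ≗ g′ → h ≗ h′ → Learns Ψ g h → Learns Ψ g′ h′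
Learns-respects-≗ {Ψ} {g} {g′} {h} {h′} g≗g′ h≗h′ (ℓ , (N , lim) , p) =
  ℓ , (N , λ n N≤n → trans (cong (fun Ψ) (sym (applyUpTo-cong g≗g′ n))) (lim n N≤n)) ,
  λ x → let c , eq , r = p x in
        c , eq , subst (g′ ⊢ c · x ⇓_) (h≗h′ x) (⇓-respects-≗ g≗g′ r)

Learns-functional : ∀ {Ψ g h h′} → Learns Ψ g h → Learns Ψ g h′ → h ≗ h′
Learns-functional (ℓ , (N , lim) , p) (ℓ′ , (N′ , lim′) , p′) x
  with trans (sym (lim (N ⊔ N′) (m≤m⊔n N N′))) (lim′ (N ⊔ N′) (m≤n⊔m N N′))
... | refl = Φ-deterministic (p x) (p′ x)

DNR-respects-≗ : ∀ {k h h′} → h ≗ h′ → h ∈ DNR k → h′ ∈ DNR k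
DNR-respects-≗ {k} h≗h′ (h<k , dnr) =
  (λ n → subst (_< k) (h≗h′ n) (h<k n)) , λ {e} p eq → dnr p (trans (h≗h′ e) eq)

DNR-mono : ∀ {k k′} → k ≤ k′ → DNR k ⊆ DNR k′
DNR-mono k≤k′ (g<k , dnr) = (λ n → <-≤-trans (g<k n) k≤k′) , dnr

n<2^n : ∀ n → n < 2 ^ n
n<2^n zero    = z<s
n<2^n (suc n) =
  +-mono-≤ (m^n>0 2 n) (≤-trans (n<2^n n) (≤-reflexive (sym (+-identityʳ (2 ^ n)))))

copier : Learner
copier = learner (lit ⌜ oracle ⌝)

copier-lim : ∀ g → Lim copier ⟨ g ⟩≡ ⌜ oracle ⌝
copier-lim g = 0 , λ _ _ → refl

≤⟨⟩-antitone : ∀ {A B B′ C} → B′ ⊆ B → A ≤⟨ C ⟩ B → A ≤⟨ C ⟩ B′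
≤⟨⟩-antitone B′⊆B (Γ , computable , total , into) =
  Γ , computable , (λ g∈ → total (B′⊆B g∈)) , λ g∈ → into (B′⊆B g∈)

⟨<ω,ω⟩⇒⟨ω,1⟩ : ∀ {A B} → A ≤⟨ ⟨<ω,ω⟩-Computable ⟩ B → A ≤⟨ ⟨ω,1⟩-Computable ⟩ B
⟨<ω,ω⟩⇒⟨ω,1⟩ (Γ , (b , learns) , total , into) =
  Γ , (λ p → let _ , _ , ℓ , _ , q = learns p in ℓ , q) , total , into

-- Teams and the choice of a level, by excluded middle

module Classical (em : ExcludedMiddle 0ℓ) where

  least : ∀ {P : ℕ → Set} n → P n → ∃ λ m → m ≤ n × P m × (∀ i → i < m → ¬ P i)
  least {P} n p with firstBelow n
    where
    firstBelow : ∀ n → (∃ λ m → m < n × P m × (∀ i → i < m → ¬ P i)) ⊎ (∀ i → i < n → ¬ P i)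
    firstBelow zero    = inj₂ λ _ ()
    firstBelow (suc n) with firstBelow n | em {P n}
    ... | inj₁ (m , m<n , first) | _      = inj₁ (m , m<n⇒m<1+n m<n , first)
    ... | inj₂ none              | yes pₙ = inj₁ (n , ≤-refl , pₙ , none)
    ... | inj₂ none              | no ¬pₙ =
      inj₂ λ i i<1+n → [ none i , (λ { refl → ¬pₙ }) ]′ (m<1+n⇒m<n∨m≡n i<1+n)
  ... | inj₁ (m , m<n , first) = m , <⇒≤ m<n , first
  ... | inj₂ none              = n , ≤-refl , p , none

  -- Several members may succeed with different results. To be single-valued, `Γ` takes the result
  -- of the first member that succeeds.
  team : ∀ {A B : Pred Baire 0ℓ} → (∀ {h h′} → h ≗ h′ → h ∈ A → h′ ∈ A) →
         (n : ℕ) (Ψ : ℕ → Learner) →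
         (∀ {g} → g ∈ B → ∃ λ j → j < n × ∃ λ h → Learns (Ψ j) g h × h ∈ A) →
         A ≤⟨ ⟨<ω,ω⟩-Computable ⟩ B
  team {A} {B} A-respects n Ψ covers =
    Γ , (proj₁ bound , λ (j , j<n , (p , _) , _) → Ψ j , proj₂ bound j j<n , p) , total ,
    λ _ (_ , _ , (_ , h∈A) , _) → h∈A
    where
    Solves : ℕ → Baire → Baire → Set
    Solves j g h = Learns (Ψ j) g h × h ∈ A

    Solves-respects : ∀ {j g g′ h h′} → g ≗ g′ → h ≗ h′ → Solves j g h → Solves j g′ h′
    Solves-respects {j} {g} {g′} {h} {h′} g≗g′ h≗h′ (p , h∈A) =
      Learns-respects-≗ {Ψ j} {g} {g′} {h} {h′} g≗g′ h≗h′ p , A-respects h≗h′ h∈A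

    First : ℕ → Baire → Set
    First j g = ∀ i → i < j → ¬ ∃ (Solves i g)

    First-unique : ∀ {i j g h h′} → First i g → First j g → Solves i g h → Solves j g h′ → i ≡ j
    First-unique firstᵢ firstⱼ p q =
      ≤-antisym (≮⇒≥ λ j<i → firstᵢ _ j<i (_ , q)) (≮⇒≥ λ i<j → firstⱼ _ i<j (_ , p))

    Graph : Baire → Baire → Set
    Graph g h = ∃ λ j → j < n × Solves j g h × First j g

    Γ : PartialFunction
    Γ = record
      { graph      = Graph
      ; respects   = (λ h≗h′ (j , j<n , p , first) → j , j<n , Solves-respects {j} (λ _ → refl) h≗h′ p , first) ,
                     (λ g≗g′ (j , j<n , p , first) → j , j<n , Solves-respects {j} g≗g′ (λ _ → refl) p ,
                        λ i i<j (h , q) → first i i<j (h , Solves-respects {i} (λ x → sym (g≗g′ x)) (λ _ → refl) q))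
      ; functional = functional′
      }
      where
      functional′ : ∀ {g h h′} → Graph g h → Graph g h′ → h ≗ h′
      functional′ {g} {h} {h′} (i , _ , p , first) (j , _ , q , first′)
        with refl ← First-unique {i} {j} {g} {h} {h′} first first′ p q =
        Learns-functional {Ψ i} {g} {h} {h′} (proj₁ p) (proj₁ q)

    bound : ∃ λ b → ∀ j → j < n → index (Ψ j) < b
    bound = collect {λ j b → index (Ψ j) < b} (λ b≤b′ p → <-≤-trans p b≤b′)
              n (λ j _ → suc (index (Ψ j)) , ≤-refl)

    total : B ⊆ dom Γ
    total g∈B =
      let j , j<n , p = covers g∈B
          i , i≤j , (h , q) , first = least {λ j → ∃ (Solves j _)} j p
      in h , i , ≤-<-trans i≤j j<n , q , first

  DNR-≤ : ∀ {k k′} → k′ ≤ k → DNR k ≤⟨ ⟨<ω,ω⟩-Computable ⟩ DNR k′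
  DNR-≤ {k} k′≤k = team (DNR-respects-≗ {k}) 1 (λ _ → copier) λ {g} g∈ →
    0 , z<s , g , (_ , copier-lim g , λ _ → oracle , refl , oracle) , DNR-mono k′≤k g∈

  module _ (k n : ℕ) .{{_ : NonZero k}} where
    open Tuples k n

    -- At level 0 every number is refuted, at level `m` some number is not; `j` is a level where
    -- this changes.
    pivot : ∀ g m → (∃ λ a → ¬ Refuted m g a) →
            ∃ λ j → j < m × (∃ λ a → ¬ Refuted (suc j) g a) × (∀ b → Refuted j g b)
    pivot g zero    (a , unrefuted) = ⊥-elim (unrefuted (refuted₀ g a))
    pivot g (suc m) unrefuted with em {∃ λ a → ¬ Refuted m g a}
    ... | yes below = let j , j<m , rest = pivot g m below in j , m<n⇒m<1+n j<m , rest
    ... | no none   = m , ≤-refl , unrefuted ,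
                      λ b → decidable-stable em (λ unrefuted → none (b , unrefuted))

    pivot-DNR : ∀ {g} → g ∈ DNR K →
                ∃ λ j → j < n × (∃ λ a → ¬ Refuted (suc j) g a) × (∀ b → Refuted j g b)
    -- At level `n` no number is refuted, so 0 is an instance.
    pivot-DNR {g} g∈ = pivot g n (0 , unrefutedₙ g∈ 0)

    guesser-learns : ∀ {g} j → g ∈ DNR K → (∃ λ a → ¬ Refuted (suc j) g a) → (∀ b → Refuted j g b) →
                     ∃ λ h → Learns (guesser j) g h × h ∈ DNR k
    guesser-learns {g} j g∈ (a , unrefuted) refuted =
      -- The guesses converge to the least unrefuted number, which replaces the given `a`.
      let a′ , _ , unrefuted′ , below = least {λ a → ¬ Refuted (suc j) g a} a unrefuted
          h , p , h∈ = pick-DNR j g∈ unrefuted′ refuted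
          lim = guesser-lim j (proj₁ g∈) unrefuted′ (λ i i<a′ → decidable-stable em (below i i<a′))
      in h , (_ , lim , p) , h∈

    DNR-root : DNR k ≤⟨ ⟨<ω,ω⟩-Computable ⟩ DNR (k ^ n)
    DNR-root = team (DNR-respects-≗ {k}) n guesser λ g∈ →
      let j , j<n , unrefuted , refuted = pivot-DNR g∈ in
      j , j<n , guesser-learns j g∈ unrefuted refuted

  -- The team of two learners and the equivalences

  pairTeam : ∀ k → ∃₂ λ Ψ₀ Ψ₁ → Confident Ψ₀ × EventuallyPopperian Ψ₁ ×
             (∀ {g} → g ∈ DNR (k ^ 2) →
               (∃ λ h → Learns Ψ₀ g h × h ∈ DNR k) ⊎ (∃ λ h → Learns Ψ₁ g h × h ∈ DNR k))
  pairTeam zero =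
    -- `DNR (0 ^ 2)` is empty, so only confidence and the Popperian property matter.
    copier , copier , (λ g → _ , copier-lim g) ,
    (λ f (N , lim) x → f x , oracle , lim N ≤-refl , oracle) ,
    λ g∈ → ⊥-elim (n≮0 (proj₁ g∈ 0))
  pairTeam k@(suc _) =
    Ψ₀ , guesser 0 , (λ _ → _ , 0 , λ _ _ → refl) , guesser₀-eventuallyPopperian , solve
    where
    open Tuples k 2

    Ψ₀ : Learner
    -- This covers `j = 1`: no number is refuted at level 2, so the fixed advice 0 is safe and the
    -- learner can be constant.
    Ψ₀ = learner (lit (smn (pick 1) 0))

    solve : ∀ {g} → g ∈ DNR (k ^ 2) →
            (∃ λ h → Learns Ψ₀ g h × h ∈ DNR k) ⊎ (∃ λ h → Learns (guesser 0) g h × h ∈ DNR k)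
    solve g∈ with pivot-DNR k 2 g∈
    ... | 0 , _ , unrefuted , refuted = inj₂ (guesser-learns k 2 0 g∈ unrefuted refuted)
    ... | 1 , _ , _ , refuted =
      let h , p , h∈ = pick-DNR 1 g∈ (unrefutedₙ g∈ 0) refuted in
      inj₁ (h , (_ , (0 , λ _ _ → refl) , p) , h∈)
    ... | suc (suc _) , s≤s (s≤s ()) , _

  DNR-square : ∀ k → DNR k ≤⟨ ⟨<ω,ω⟩-Computable ⟩ DNR (k ^ 2)
  DNR-square zero    = DNR-≤ z≤n
  DNR-square k@(suc _) = DNR-root k 2

  DNR-≡ : ∀ k → k ≥ 2 → DNR k ≡⟨ ⟨<ω,ω⟩-Computable ⟩ DNR 2
  DNR-≡ k k≥2 = DNR-≤ k≥2 , ≤⟨⟩-antitone {B = DNR (2 ^ k)} (DNR-mono (<⇒≤ (n<2^n k))) (DNR-root 2 k)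

corollary72 : ExcludedMiddle 0ℓ →
    (∀ (k : ℕ) → k ≥ 2 → DNR k ≡⟨ ⟨<ω,ω⟩-Computable ⟩ DNR 2)
    × (∀ (k : ℕ) →
         DNR k ≤⟨ ⟨<ω,ω⟩-Computable ⟩ DNR (k ^ 2)
         × (∃₂ λ Ψ₀ Ψ₁ →
              Confident Ψ₀ × EventuallyPopperian Ψ₁ ×
              (∀ {g} → g ∈ DNR (k ^ 2) →
                (∃ λ h → Learns Ψ₀ g h × h ∈ DNR k)
                ⊎ (∃ λ h → Learns Ψ₁ g h × h ∈ DNR k))))
    × (∀ (k : ℕ) → k ≥ 2 → DNR k ≡⟨ ⟨ω,1⟩-Computable ⟩ DNR 2)
corollary72 em =
  DNR-≡ ,
  (λ k → DNR-square k , pairTeam k) ,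
  λ k k≥2 → let up , down = DNR-≡ k k≥2 in ⟨<ω,ω⟩⇒⟨ω,1⟩ up , ⟨<ω,ω⟩⇒⟨ω,1⟩ down
  where open Classical em
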